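{- Let $l\ge1$, $n\ge1$, and let $a,b\ge1$ with $a+b=ln$. With $Q_{m,k}:=\sum_{j\ge0}Q_{m,k,j}$, $$\sum_{i=0}^{n-1}h_{i}\,Q_{n-i,a-1}=\sum_{i=0}^{n-1}h_i\,Q_{n-i,b-1},$$ where $h_i$ is the complete homogeneous symmetric function of degree $i$ in $x_1,x_2,\dots$ ($h_0=1$).
   Context: Fix a positive integer $l$. Let $\mathcal{B}$ be the totally ordered alphabet $1^0<1^1<\cdots<1^{l-1}<\overline{1^0}<2^0<2^1<\cdots<2^{l-1}<\overline{2^0}<3^0<\cdots$. For $u\ge1$, $0\le m\le l-1$, the letter $u^m$ is called $m$-colored (unbarred), and $\overline{u^0}$ is called $0$-colored and barred. The absolute value of $u^m$ and of $\overline{u^0}$ is $u$, and the weight of either letter is $x_u$. A circular word $(w)$ is $w$ written clockwise around a circle (up to rotation); it is primitive if $w$ is not $w'w'\cdots w'$ ($\ge2$ copies) for some word $w'$. A colored necklace is a primitive circular word over $\mathcal{B}$ such that (1) every barred letter is followed (clockwise) by a letter of lesser or equal absolute value, (2) every $0$-colored unbarred letter is followed by a letter of greater or equal absolute value, (3) a necklace of length one is not a single barred letter. A colored ornament is a finite multiset of colored necklaces; its length is its total number of letters, its weight $\mathrm{wt}(R)$ is the product of the weights of its letters, and $\mathrm{col}_m(R)$ ($1\le m\le l-1$) is its number of $m$-colored letters. The flag Eulerian quasisymmetric function is (via Hyatt's colored-ornament interpretation, taken here as the definition) $Q_{n,k,j}=\sum_R\mathrm{wt}(R)$, summed over colored ornaments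 $R$ of length $n$ with $l\cdot(\#\text{barred letters of }R)+\sum_{m=1}^{l-1}m\,\mathrm{col}_m(R)=k$ and exactly $j$ necklaces of length one consisting of a $0$-colored letter. -}

module Defs where

open import Data.Nat using (ℕ; zero; suc; _+_; _*_; _∸_; _≤ᵇ_; _<ᵇ_; _≡ᵇ_; _/_; _≤_)
import Data.Nat as ℕ
open import Data.Nat.Divisibility using (_∣?_)
open import Data.Bool using (Bool; true; false; _∧_; _∨_; not; if_then_else_)
open import Data.Fin using (Fin; toℕ)
import Data.Fin as Fin
open import Data.List using (List; []; _∷_; _++_; length; concat; concatMap; replicate; take; zip; upTo; filterᵇ; allFin)
open import Data.Bool.ListAction using (all; any)
import Data.Nat.ListAction as NL
import Data.List as L
import Data.List.Properties as LP
open import Data.Vec using (Vec; []; _∷_; tabulate; zipWith)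
import Data.Vec as V
import Data.Vec.Properties as VP
open import Data.Product using (_×_; _,_; uncurry)
open import Relation.Nullary.Decidable using (⌊_⌋; yes; no; map′)
open import Relation.Binary.PropositionalEquality using (_≡_; refl; cong; cong₂)
open import Relation.Binary.Definitions using (DecidableEquality)

-- Letters of the colored alphabet B, restricted to absolute values 1..N.
-- unb u m  is the letter (u+1)^m  (u : Fin N is the 0-based absolute value),
-- bar u    is the barred letter  overline{(u+1)^0}.

data Letter (l N : ℕ) : Set where
  unb : Fin N → Fin l → Letter l N
  bar : Fin N → Letter l N

module _ {l N : ℕ} where

  -- absolute value minus one
  absv : Letter l N → ℕ
  absv (unb u _) = toℕ u
  absv (bar u)   = toℕ u

  -- position in the total order 1^0<...<1^{l-1}<bar1<2^0<...
  key : Letter l N → ℕ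
  key (unb u m) = toℕ u * suc l + toℕ m
  key (bar u)   = toℕ u * suc l + l

  _≟L_ : DecidableEquality (Letter l N)
  unb u m ≟L unb v k with u Fin.≟ v | m Fin.≟ k
  ... | yes refl | yes refl = yes refl
  ... | no p     | _        = no λ { refl → p refl }
  ... | yes _    | no q     = no λ { refl → q refl }
  unb u m ≟L bar v = no λ ()
  bar u ≟L unb v k = no λ ()
  bar u ≟L bar v with u Fin.≟ v
  ... | yes refl = yes refl
  ... | no p     = no λ { refl → p refl }

  wordEq : List (Letter l N) → List (Letter l N) → Bool
  wordEq w v = ⌊ LP.≡-dec _≟L_ w v ⌋

  -- conditions (1),(2) on a letter x followed clockwise by y
  okPair : Letter l N → Letter l N → Bool
  okPair (bar u)   y = absv y ≤ᵇ toℕ u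
  okPair (unb u m) y = if toℕ m ≡ᵇ 0 then toℕ u ≤ᵇ absv y else true

  rot1 : List (Letter l N) → List (Letter l N)
  rot1 []       = []
  rot1 (x ∷ xs) = xs ++ x ∷ []

  rotate : ℕ → List (Letter l N) → List (Letter l N)
  rotate zero    w = w
  rotate (suc d) w = rotate d (rot1 w)

  cycOK : List (Letter l N) → Bool
  cycOK w = all (uncurry okPair) (zip w (rot1 w))

  notSingleBar : List (Letter l N) → Bool
  notSingleBar (bar _ ∷ []) = false
  notSingleBar _            = true

  -- w is primitive: there is no k ≥ 2 and w' with w = w'^k
  -- (necessarily |w'| = |w|/k, so w' = take (|w|/k) w; k ranges over 2..|w|+1)
  isPrimitive : List (Letter l N) → Bool
  isPrimitive w = not (any test (upTo (length w)))
    where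
    test : ℕ → Bool
    test j = ⌊ suc (suc j) ∣? length w ⌋
             ∧ wordEq (concat (replicate (suc (suc j)) (take (length w / suc (suc j)) w))) w

  lexLeq : List (Letter l N) → List (Letter l N) → Bool
  lexLeq []       _        = true
  lexLeq (_ ∷ _)  []       = false
  lexLeq (x ∷ xs) (y ∷ ys) = (key x <ᵇ key y) ∨ ((key x ≡ᵇ key y) ∧ lexLeq xs ys)

  -- canonical representative of a circular word: lexicographically least rotation
  isCanonical : List (Letter l N) → Bool
  isCanonical w = all (λ d → lexLeq w (rotate d w)) (upTo (length w))

  isNecklace : List (Letter l N) → Bool
  isNecklace w = isPrimitive w ∧ cycOK w ∧ notSingleBar w

allLetters : (l N : ℕ) → List (Letter l N)
allLetters l N = concatMap (λ u → L.map (unb u) (allFin l) ++ bar u ∷ []) (allFin N)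

allWords : (l N : ℕ) → ℕ → List (List (Letter l N))
allWords l N zero    = [] ∷ []
allWords l N (suc s) = concatMap (λ x → L.map (x ∷_) (allWords l N s)) (allLetters l N)

necklaces : (l N : ℕ) → ℕ → List (List (Letter l N))
necklaces l N s = filterᵇ (λ w → isNecklace w ∧ isCanonical w) (allWords l N s)

-- lists of necklaces of total length r (fuel argument first)
necklaceLists : (l N : ℕ) → ℕ → ℕ → List (List (List (Letter l N)))
necklaceLists l N _       zero    = [] ∷ []
necklaceLists l N zero    (suc r) = []
necklaceLists l N (suc f) (suc r) =
  concatMap (λ s → concatMap (λ nk → L.map (nk ∷_) (necklaceLists l N f (suc r ∸ s)))
                             (necklaces l N s))
            (L.map suc (upTo (suc r)))

sortedB : {l N : ℕ} → List (List (Letter l N)) → Bool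
sortedB []           = true
sortedB (_ ∷ [])     = true
sortedB (x ∷ y ∷ rs) = lexLeq x y ∧ sortedB (y ∷ rs)

-- colored ornaments of length m: finite multisets of necklaces,
-- represented as lexicographically nondecreasing lists of canonical representatives
ornaments : (l N : ℕ) → ℕ → List (List (List (Letter l N)))
ornaments l N m = filterᵇ sortedB (necklaceLists l N m m)

module _ {l N : ℕ} where

  -- contribution to  l·#barred + Σ m·col_m
  letterStat : Letter l N → ℕ
  letterStat (unb _ m) = toℕ m
  letterStat (bar _)   = l

  ornStat : List (List (Letter l N)) → ℕ
  ornStat R = NL.sum (L.map letterStat (concat R))

  single0 : List (Letter l N) → Bool
  single0 (unb _ m ∷ []) = toℕ m ≡ᵇ 0
  single0 (bar _ ∷ [])   = true
  single0 _              = false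

  numSingle0 : List (List (Letter l N)) → ℕ
  numSingle0 R = length (filterᵇ single0 R)

  -- exponent vector of wt(R) in x_1..x_N
  content : List (List (Letter l N)) → Vec ℕ N
  content R = tabulate (λ u → length (filterᵇ (λ x → absv x ≡ᵇ toℕ u) (concat R)))

vecEq : {N : ℕ} → Vec ℕ N → Vec ℕ N → Bool
vecEq α β = ⌊ VP.≡-dec ℕ._≟_ α β ⌋

-- coefficient of x^α (α supported on x_1..x_N) in Q_{m,k,j}
coefQ3 : (l N m k j : ℕ) → Vec ℕ N → ℕ
coefQ3 l N m k j α =
  length (filterᵇ (λ R → (ornStat R ≡ᵇ k) ∧ (numSingle0 R ≡ᵇ j) ∧ vecEq (content R) α)
                  (ornaments l N m))

-- coefficient of x^α in Q_{m,k} = Σ_{j ≥ 0} Q_{m,k,j}  (terms with j > m vanish)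
coefQ : (l N m k : ℕ) → Vec ℕ N → ℕ
coefQ l N m k α = NL.sum (L.map (λ j → coefQ3 l N m k j α) (upTo (suc m)))

coefH : {N : ℕ} → ℕ → Vec ℕ N → ℕ
coefH i β = if V.sum β ≡ᵇ i then 1 else 0

below : {N : ℕ} → Vec ℕ N → List (Vec ℕ N)
below []      = [] ∷ []
below (a ∷ α) = concatMap (λ c → L.map (c ∷_) (below α)) (upTo (suc a))

coefProd : {N : ℕ} → (Vec ℕ N → ℕ) → (Vec ℕ N → ℕ) → Vec ℕ N → ℕ
coefProd f g α = NL.sum (L.map (λ β → f β * g (zipWith _∸_ α β)) (below α))

coefSide : (l N n c : ℕ) → Vec ℕ N → ℕ
coefSide l N n c α = NL.sum (L.map (λ i → coefProd (coefH i) (coefQ l N (n ∸ i) c) α) (upTo n))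

{-# OPTIONS --safe #-}

-- Write H for the sum of all h_i, H′ for H with x_u replaced by t^l x_u, Q for the generating series of
-- all ornaments (t marking the statistic), and G for that of the ornaments without one-letter necklaces
-- u^0. Adjoining the necklaces u^0 gives Q = H G. Adjoining the (forbidden) necklaces bar u instead gives
-- W = H′ G, and by the Chen-Fox-Lyndon factorization W counts the words satisfying (1) and (2) at
-- consecutive letters and not ending in some u^0. Splitting off the first letter yields a recurrence on
-- the words whose first letter has absolute value < s, whose solution is W (H′ - t H) = (1 - t) H′, so
-- that G (H′ - t H) = 1 - t. Hence G is invariant under t ↦ 1/t, x_u ↦ t^l x_u, and t (H Q - H) is
-- invariant up to H′ - H, which only involves t^0 and t^{ln} in degree n. Products with H and H′ are
-- handled through the inverses ∏ (1 - x_u) and ∏ (1 - t^l x_u).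
module Submission where

open import Defs
open import Data.Nat using (ℕ; zero; suc; _∸_; z≤n; s≤s; _≡ᵇ_)
import Data.Nat as ℕ
import Data.Nat.Properties as ℕP
import Data.Nat.DivMod as DM
import Data.Nat.Tactic.RingSolver as ℕSolver
open import Data.Nat.Divisibility using (_∣?_; divides)
open import Data.Nat.ListAction using (sum)
import Data.Nat.ListAction.Properties as NLP
open import Data.Integer using (ℤ)
import Data.Integer as ℤ
import Data.Integer.Properties as ℤP
open import Data.Integer.Tactic.RingSolver using (solve-∀)
open import Data.Bool using (Bool; true; false; T; T?; _∧_; not; if_then_else_)
import Data.Bool.Properties as BP
open import Data.Bool.ListAction using (all)
open import Data.Fin using (Fin; zero; suc; toℕ; fromℕ<)
import Data.Fin.Properties as FP
open import Data.Vec using (Vec; []; _∷_; tabulate; zipWith)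
import Data.Vec as V
import Data.Vec.Properties as VP
open import Data.Maybe using (Maybe; just; nothing; maybe′; _>>=_)
import Data.Maybe as M
open import Data.Maybe.Properties using (just-injective)
open import Data.List using (List; []; _∷_; _++_; length; concat; concatMap; replicate; take; drop; zip; upTo; applyUpTo; allFin; filter; filterᵇ)
import Data.List as L
import Data.List.Properties as LP
open import Data.List.Membership.Propositional using (_∈_; find; lose)
open import Data.List.Membership.Propositional.Properties
  using (∈-∃++; ∈-map⁺; ∈-map⁻; ∈-concatMap⁺; ∈-concatMap⁻; ∈-filter⁺; ∈-filter⁻; ∈-++⁺ˡ; ∈-++⁺ʳ; ∈-++⁻; ∈-allFin; ∈-upTo⁺; ∈-upTo⁻)
open import Data.List.Relation.Unary.Any using (here; there; any?)
import Data.List.Relation.Unary.Any.Properties as AnyP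
open import Data.List.Relation.Unary.All as All using (All; []; _∷_)
import Data.List.Relation.Unary.All.Properties as AllP
open import Data.List.Relation.Unary.AllPairs using (AllPairs; []; _∷_)
open import Data.List.Relation.Unary.Linked using (Linked; []; [-]; _∷_)
open import Data.List.Relation.Unary.Linked.Properties using (Linked⇒AllPairs; AllPairs⇒Linked)
open import Data.List.Relation.Unary.Unique.Propositional using (Unique)
import Data.List.Relation.Unary.Unique.Propositional.Properties as UP
open import Data.List.Relation.Binary.Permutation.Propositional using (_↭_; ↭-refl; ↭-trans; ↭-reflexive)
open import Data.List.Relation.Binary.Permutation.Propositional.Properties using (filter-↭; ↭-length; ++⁺ˡ; ++⁺ʳ; ++-comm)
import Data.List.Relation.Binary.Permutation.Propositional.Properties as PP
open import Data.Product using (_×_; _,_; proj₁; proj₂; ∃-syntax; uncurry)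
open import Data.Sum using (_⊎_; inj₁; inj₂)
import Data.Sum as Sum
open import Data.Empty using (⊥; ⊥-elim)
open import Data.Unit using (⊤; tt)
open import Function using (_∘_; id)
open import Function.Bundles using (_⇔_; Equivalence; mk⇔)
open import Relation.Nullary using (¬_; yes; no; Dec)
open import Relation.Nullary.Decidable using (⌊_⌋; fromWitness; toWitness; ¬?; _×-dec_; _⊎-dec_)
open import Relation.Unary using (Decidable)
open import Relation.Binary.Definitions using (Tri; tri<; tri≈; tri>)
open import Relation.Binary.PropositionalEquality


-- The exchange of u^0 for bar u rests on the order: among the letters of absolute value u, u^0 is
-- the least and bar u the greatest. Hence at a weak descent only a letter u^0 can violate (1) or
-- (2). From the last letter of a Lyndon word of length at least two back to its first there is a
-- strict descent, and at the junction of two consecutive factors a weak one. So the linear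
-- conditions on a word say that all its factors close up cyclically and none is a single u^0, while
-- a single bar u does no harm.
--
-- Ornaments are counted as words too: an ornament is encoded by the concatenation of its Lyndon
-- factors, and a condition on its necklaces becomes one on the factors.
--
-- Series are arbitrary functions of the exponents, and no general product is defined. The price is
-- that 1 - t cannot be cancelled: it kills every function constant in the exponent of t. So the
-- equation for G alone does not give uniqueness, and a sign argument has to complete it. Products
-- over u have constant term 1 and are cancelled in the least degree.

-- Formal series in t and x_1, ..., x_N; multiplication by linear factors.

module FormalSeries where

  open import Data.Integer using (ℤ; +_; -[1+_]; -_; _+_; _-_; 0ℤ; 1ℤ; -1ℤ)

  -- F k α is the coefficient of t^k x^α; k ranges over ℤ so that t ↦ 1/t makes sense.
  Series : ℕ → Set
  Series N = ℤ → Vec ℕ N → ℤ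

  module _ {N : ℕ} where

    infix 4 _≈_
    infixl 6 _⊝_

    record _≈_ (F G : Series N) : Set where
      constructor pointwise
      field at : ∀ k α → F k α ≡ G k α

    open _≈_ public

    _⊝_ : Series N → Series N → Series N
    (F ⊝ G) k α = F k α - G k α

    ≈-refl : ∀ {F} → F ≈ F
    ≈-refl = pointwise λ _ _ → refl

    ≈-sym : ∀ {F G} → F ≈ G → G ≈ F
    ≈-sym p = pointwise λ k α → sym (at p k α)

    ≈-trans : ∀ {F G H} → F ≈ G → G ≈ H → F ≈ H
    ≈-trans p q = pointwise λ k α → trans (at p k α) (at q k α)

    ⊝-cong : ∀ {F F′ G G′} → F ≈ F′ → G ≈ G′ → F ⊝ G ≈ F′ ⊝ G′
    ⊝-cong p q = pointwise λ k α → cong₂ _-_ (at p k α) (at q k α)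

  inc : ∀ {N} → Fin N → Vec ℕ N → Vec ℕ N
  inc zero    (a ∷ α) = suc a ∷ α
  inc (suc u) (a ∷ α) = a ∷ inc u α

  dec : ∀ {N} → Fin N → Vec ℕ N → Maybe (Vec ℕ N)
  dec zero    (zero  ∷ α) = nothing
  dec zero    (suc a ∷ α) = just (a ∷ α)
  dec (suc u) (a ∷ α)     = M.map (a ∷_) (dec u α)

  dec-inc : ∀ {N} (u : Fin N) α → dec u (inc u α) ≡ just α
  dec-inc zero    (a ∷ α) = refl
  dec-inc (suc u) (a ∷ α) = cong (M.map (a ∷_)) (dec-inc u α)

  dec⇒inc : ∀ {N} (u : Fin N) α {β} → dec u α ≡ just β → α ≡ inc u β
  dec⇒inc zero    (suc a ∷ α) refl = refl
  dec⇒inc (suc u) (a ∷ α) p with dec u α in eq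
  dec⇒inc (suc u) (a ∷ α) refl | just β = cong (a ∷_) (dec⇒inc u α eq)

  inc-comm : ∀ {N} (u v : Fin N) α → inc u (inc v α) ≡ inc v (inc u α)
  inc-comm zero    zero    (a ∷ α) = refl
  inc-comm zero    (suc v) (a ∷ α) = refl
  inc-comm (suc u) zero    (a ∷ α) = refl
  inc-comm (suc u) (suc v) (a ∷ α) = cong (a ∷_) (inc-comm u v α)

  sum-inc : ∀ {N} (u : Fin N) α → V.sum (inc u α) ≡ suc (V.sum α)
  sum-inc zero    (a ∷ α) = refl
  sum-inc (suc u) (a ∷ α) = trans (cong (a ℕ.+_) (sum-inc u α)) (ℕP.+-suc a (V.sum α))

  dec-comm : ∀ {N} (u v : Fin N) α → (dec u α >>= dec v) ≡ (dec v α >>= dec u)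
  dec-comm zero    zero    (zero ∷ α)  = refl
  dec-comm zero    zero    (suc a ∷ α) = refl
  dec-comm zero    (suc v) (zero ∷ α) with dec v α
  ... | nothing = refl
  ... | just _  = refl
  dec-comm zero    (suc v) (suc a ∷ α) with dec v α
  ... | nothing = refl
  ... | just _  = refl
  dec-comm (suc u) zero (zero ∷ α) with dec u α
  ... | nothing = refl
  ... | just _  = refl
  dec-comm (suc u) zero (suc a ∷ α) with dec u α
  ... | nothing = refl
  ... | just _  = refl
  dec-comm (suc u) (suc v) (a ∷ α) = trans (push u v) (trans (cong (M.map (a ∷_)) (dec-comm u v α)) (sym (push v u)))
    where
    push : ∀ u v → (M.map (a ∷_) (dec u α) >>= dec (suc v)) ≡ M.map (a ∷_) (dec u α >>= dec v)
    push u v with dec u α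
    ... | nothing = refl
    ... | just _  = refl

  module _ {N : ℕ} where

    -- sh d, X u and y d u multiply by t^d, x_u and 1 - t^d x_u.
    sh : ℤ → Series N → Series N
    sh d F k α = F (k - d) α

    X : Fin N → Series N → Series N
    X u F k α = maybe′ (F k) 0ℤ (dec u α)

    y : ℕ → Fin N → Series N → Series N
    y d u F = F ⊝ X u (sh (+ d) F)

    X-cong : ∀ u {F G} → F ≈ G → X u F ≈ X u G
    X-cong u {F} {G} p = pointwise pt
      where
      pt : ∀ k α → X u F k α ≡ X u G k α
      pt k α with dec u α
      ... | nothing = refl
      ... | just β  = at p k β

    X-⊝ : ∀ u F G → X u (F ⊝ G) ≈ X u F ⊝ X u G
    X-⊝ u F G = pointwise pt
      where
      pt : ∀ k α → X u (F ⊝ G) k α ≡ (X u F ⊝ X u G) k α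
      pt k α with dec u α
      ... | nothing = refl
      ... | just β  = refl

    X-comm : ∀ u v F → X u (X v F) ≈ X v (X u F)
    X-comm u v F = pointwise λ k α → trans (two k α u v) (trans (cong (maybe′ (F k) 0ℤ) (dec-comm u v α)) (sym (two k α v u)))
      where
      two : ∀ k α u v → X u (X v F) k α ≡ maybe′ (F k) 0ℤ (dec u α >>= dec v)
      two k α u v with dec u α
      ... | nothing = refl
      ... | just β  = refl

    sh-comm : ∀ d e F → sh d (sh e F) ≈ sh e (sh d F)
    sh-comm d e F = pointwise λ k α → cong (λ i → F i α) (lemma k d e)
      where
      lemma : ∀ k d e → k - d - e ≡ k - e - d
      lemma = solve-∀

    sh-cong : ∀ d {F G : Series N} → F ≈ G → sh d F ≈ sh d G
    sh-cong d p = pointwise λ k α → at p (k - d) α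

    y-cong : ∀ d u {F G} → F ≈ G → y d u F ≈ y d u G
    y-cong d u p = ⊝-cong p (X-cong u (sh-cong (+ d) p))

    y-⊝ : ∀ d u F G → y d u (F ⊝ G) ≈ y d u F ⊝ y d u G
    y-⊝ d u F G = pointwise λ k α →
      trans (cong (λ z → F k α - G k α - z) (at (X-⊝ u (sh (+ d) F) (sh (+ d) G)) k α))
            (lemma (F k α) (G k α) (X u (sh (+ d) F) k α) (X u (sh (+ d) G) k α))
      where
      lemma : ∀ a b c e → a - b - (c - e) ≡ a - c - (b - e)
      lemma = solve-∀

    y-sh : ∀ d u e F → y d u (sh e F) ≈ sh e (y d u F)
    y-sh d u e F = pointwise λ k α → cong (λ z → F (k - e) α - z) (at (X-cong u (sh-comm (+ d) e F)) k α)

    y-comm : ∀ d u e v F → y d u (y e v F) ≈ y e v (y d u F)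
    y-comm d u e v F = pointwise λ k α →
      trans (cong (λ z → F k α - X v (sh (+ e) F) k α - z) (at (X-⊝ u (sh (+ d) F) (sh (+ d) (X v (sh (+ e) F)))) k α))
     (trans (lemma (F k α) (X v (sh (+ e) F) k α) (X u (sh (+ d) F) k α) (X u (sh (+ d) (X v (sh (+ e) F))) k α))
     (trans (cong (λ z → F k α - X u (sh (+ d) F) k α - (X v (sh (+ e) F) k α - z)) (at swap k α))
            (cong (λ z → F k α - X u (sh (+ d) F) k α - z) (sym (at (X-⊝ v (sh (+ e) F) (sh (+ e) (X u (sh (+ d) F)))) k α)))))
      where
      lemma : ∀ a b c e → a - b - (c - e) ≡ a - c - (b - e)
      lemma = solve-∀
      swap : X u (X v (sh (+ d) (sh (+ e) F))) ≈ X v (X u (sh (+ e) (sh (+ d) F)))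
      swap = ≈-trans (X-comm u v _) (X-cong v (X-cong u (sh-comm (+ d) (+ e) F)))

    -- Multiplication by ∏_u (1 - t^d x_{ι u}).
    B : ℕ → {n : ℕ} → (Fin n → Fin N) → Series N → Series N
    B d {zero}  ι F = F
    B d {suc n} ι F = y d (ι zero) (B d (ι ∘ suc) F)

    B-cong : ∀ d {n} (ι : Fin n → Fin N) {F G} → F ≈ G → B d ι F ≈ B d ι G
    B-cong d {zero}  ι p = p
    B-cong d {suc n} ι p = y-cong d (ι zero) (B-cong d (ι ∘ suc) p)

    B-⊝ : ∀ d {n} (ι : Fin n → Fin N) F G → B d ι (F ⊝ G) ≈ B d ι F ⊝ B d ι G
    B-⊝ d {zero}  ι F G = ≈-refl
    B-⊝ d {suc n} ι F G = ≈-trans (y-cong d (ι zero) (B-⊝ d (ι ∘ suc) F G)) (y-⊝ d (ι zero) (B d (ι ∘ suc) F) (B d (ι ∘ suc) G))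

    B-sh : ∀ d {n} (ι : Fin n → Fin N) e F → B d ι (sh e F) ≈ sh e (B d ι F)
    B-sh d {zero}  ι e F = ≈-refl
    B-sh d {suc n} ι e F = ≈-trans (y-cong d (ι zero) (B-sh d (ι ∘ suc) e F)) (y-sh d (ι zero) e (B d (ι ∘ suc) F))

    B-y : ∀ d {n} (ι : Fin n → Fin N) e v F → B d ι (y e v F) ≈ y e v (B d ι F)
    B-y d {zero}  ι e v F = ≈-refl
    B-y d {suc n} ι e v F = ≈-trans (y-cong d (ι zero) (B-y d (ι ∘ suc) e v F)) (y-comm d (ι zero) e v (B d (ι ∘ suc) F))

    B-comm : ∀ d {n} (ι : Fin n → Fin N) e {m} (κ : Fin m → Fin N) F → B d ι (B e κ F) ≈ B e κ (B d ι F)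
    B-comm d ι e {zero}  κ F = ≈-refl
    B-comm d ι e {suc m} κ F = ≈-trans (B-y d ι e (κ zero) _) (y-cong e (κ zero) (B-comm d ι e (κ ∘ suc) F))

    -- Each step trades one linear factor for another. These operators commute, so the step of the
    -- first letter can be carried out under the product over the remaining ones, and the trades
    -- multiply up.
    B-chain : ∀ d e {n} (ι : Fin n → Fin N) (E : ℕ → Series N) →
              (∀ u → y d (ι u) (E (suc (toℕ u))) ≈ y e (ι u) (E (toℕ u))) → B d ι (E n) ≈ B e ι (E 0)
    B-chain d e {zero}  ι E step = ≈-refl
    B-chain d e {suc n} ι E step =
      ≈-trans (y-cong d (ι zero) (B-chain d e (ι ∘ suc) (E ∘ suc) (step ∘ suc)))
     (≈-trans (≈-sym (B-y e (ι ∘ suc) d (ι zero) (E 1)))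
     (≈-trans (B-cong e (ι ∘ suc) (step zero)) (B-y e (ι ∘ suc) e (ι zero) (E 0))))

    B-telescope : ∀ d {n} (ι : Fin n → Fin N) (E : ℕ → Series N) →
                  (∀ u → y d (ι u) (E (suc (toℕ u))) ≈ E (toℕ u)) → B d ι (E n) ≈ E 0
    B-telescope d {zero}  ι E step = ≈-refl
    B-telescope d {suc n} ι E step =
      ≈-trans (y-cong d (ι zero) (B-telescope d (ι ∘ suc) (E ∘ suc) (step ∘ suc))) (step zero)

    VanishesBelow : ℕ → Series N → Set
    VanishesBelow m F = ∀ k β → V.sum β ℕ.< m → F k β ≡ 0ℤ

    -- The subtracted term reads `F` at a vector of degree one less, where `F` vanishes.
    y-lowest : ∀ d u {m F} → VanishesBelow m F → ∀ k α → V.sum α ℕ.≤ m → y d u F k α ≡ F k α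
    y-lowest d u {m} {F} van k α α≤m with dec u α in eq
    ... | nothing = ℤP.+-identityʳ (F k α)
    ... | just β  = trans (cong (λ z → F k α - z) (van _ β β<m)) (ℤP.+-identityʳ (F k α))
      where
      β<m : V.sum β ℕ.< m
      β<m = ℕP.≤-trans (ℕP.≤-reflexive (sym (trans (cong V.sum (dec⇒inc u α eq)) (sum-inc u β)))) α≤m

    B-lowest : ∀ d {n} (ι : Fin n → Fin N) {m F} → VanishesBelow m F → ∀ k α → V.sum α ℕ.≤ m → B d ι F k α ≡ F k α
    B-lowest d {zero}  ι van k α α≤m = refl
    B-lowest d {suc n} ι van k α α≤m =
      trans (y-lowest d (ι zero) (λ i β β<m → trans (rec i β (ℕP.<⇒≤ β<m)) (van i β β<m)) k α α≤m) (rec k α α≤m)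
      where rec = B-lowest d (ι ∘ suc) van

    -- Induction on the degree, for all powers of t at once: a nonzero series would have a nonzero
    -- coefficient of least degree.
    vanishing : ∀ {F} → (∀ m → VanishesBelow m F → ∀ k α → V.sum α ≡ m → F k α ≡ 0ℤ) → ∀ k α → F k α ≡ 0ℤ
    vanishing {F} step k α = below-all (suc (V.sum α)) k α (ℕP.n<1+n _)
      where
      below-all : ∀ m → VanishesBelow m F
      below-all (suc m) k β (s≤s β≤m) with ℕP.m≤n⇒m<n∨m≡n β≤m
      ... | inj₁ β<m = below-all m k β β<m
      ... | inj₂ β≡m = step m (below-all m) k β β≡m

    -- The product has constant term 1, so it leaves the coefficients of least degree unchanged.
    -- This cancels it without an inverse series.
    B-injective : ∀ d {n} (ι : Fin n → Fin N) {F} → (∀ k α → B d ι F k α ≡ 0ℤ) → ∀ k α → F k α ≡ 0ℤ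
    B-injective d ι {F} zer = vanishing λ m van k α α≡m →
      trans (sym (B-lowest d ι van k α (ℕP.≤-reflexive α≡m))) (zer k α)

  -- Operators in the later variables leave the first exponent alone, so it can be frozen. This is
  -- the passage from N + 1 to N variables in `B-hconv`.
  B-tail : ∀ d {N n} (ι : Fin n → Fin N) F k a α →
           B d (suc ∘ ι) F k (a ∷ α) ≡ B d ι (λ i β → F i (a ∷ β)) k α
  B-tail d {n = zero}  ι F k a α = refl
  B-tail d {n = suc n} ι F k a α =
    cong₂ _-_ (B-tail d (ι ∘ suc) F k a α)
              (trans (maybe-map (dec (ι zero) α))
                     (at (X-cong (ι zero) (pointwise λ i β → B-tail d (ι ∘ suc) F (i - + d) a β)) k α))
    where
    maybe-map : ∀ {A C : Set} {f : A → C} {g : C → ℤ} {z} m → maybe′ g z (M.map f m) ≡ maybe′ (g ∘ f) z m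
    maybe-map (just _) = refl
    maybe-map nothing  = refl

  -- Convolution with the complete homogeneous functions.

  sumℤ : List ℤ → ℤ
  sumℤ = L.foldr _+_ 0ℤ

  -- Multiplication by the sum of all h_i.
  hconv : ∀ {N} → Series N → Series N
  hconv F k α = sumℤ (L.map (λ β → F k (zipWith _∸_ α β)) (below α))

  sumℤ-++ : ∀ xs ys → sumℤ (xs ++ ys) ≡ sumℤ xs + sumℤ ys
  sumℤ-++ []       ys = sym (ℤP.+-identityˡ _)
  sumℤ-++ (x ∷ xs) ys = trans (cong (λ z → x + z) (sumℤ-++ xs ys)) (sym (ℤP.+-assoc x _ _))

  sumℤ-concatMap : ∀ {A B : Set} (h : B → ℤ) (f : A → List B) xs →
                   sumℤ (L.map h (concatMap f xs)) ≡ sumℤ (L.map (λ x → sumℤ (L.map h (f x))) xs)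
  sumℤ-concatMap h f []       = refl
  sumℤ-concatMap h f (x ∷ xs) =
    trans (cong sumℤ (LP.map-++ h (f x) _))
   (trans (sumℤ-++ (L.map h (f x)) _) (cong (λ z → sumℤ (L.map h (f x)) + z) (sumℤ-concatMap h f xs)))

  applyUpTo-cong : ∀ {A : Set} {f g : ℕ → A} → (∀ i → f i ≡ g i) → ∀ n → applyUpTo f n ≡ applyUpTo g n
  applyUpTo-cong p zero    = refl
  applyUpTo-cong p (suc n) = cong₂ _∷_ (p 0) (applyUpTo-cong (p ∘ suc) n)

  hconv-∷ : ∀ {N} (F : Series (suc N)) k a α →
            hconv F k (a ∷ α) ≡ sumℤ (applyUpTo (λ c → hconv (λ i β → F i (a ∸ c ∷ β)) k α) (suc a))
  hconv-∷ F k a α =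
    trans (sumℤ-concatMap h (λ c → L.map (c ∷_) (below α)) (upTo (suc a)))
   (trans (cong sumℤ (LP.map-upTo (λ c → sumℤ (L.map h (L.map (c ∷_) (below α)))) (suc a)))
          (cong sumℤ (applyUpTo-cong {g = λ c → hconv (λ i β → F i (a ∸ c ∷ β)) k α}
                                     (λ c → cong sumℤ (sym (LP.map-∘ {g = h} {f = c ∷_} (below α)))) (suc a))))
    where
    h = λ γ → F k (zipWith _∸_ (a ∷ α) γ)

  -- Each factor 1 - x_u telescopes the sum over the exponent of x_u. The first factor is moved
  -- inside by `B-y`, so that it meets `hconv` before the first exponent is frozen.
  B-hconv : ∀ {N} (F : Series N) → B 0 id (hconv F) ≈ F
  B-hconv {zero}  F = pointwise λ { k [] → ℤP.+-identityʳ (F k []) }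
  B-hconv {suc N} F = pointwise λ { k (a ∷ α) →
    trans (sym (at (B-y 0 suc 0 zero (hconv F)) k (a ∷ α)))
   (trans (B-tail 0 id (y 0 zero (hconv F)) k a α)
   (trans (at (B-cong 0 id (pointwise (head-step a))) k α) (at (B-hconv (λ i β → F i (a ∷ β))) k α))) }
    where
    cancel : ∀ p q → p + q - q ≡ p
    cancel = solve-∀
    head-step : ∀ a i β → y 0 zero (hconv F) i (a ∷ β) ≡ hconv (λ i β → F i (a ∷ β)) i β
    head-step zero i β =
      trans (ℤP.+-identityʳ _) (trans (hconv-∷ F i 0 β) (ℤP.+-identityʳ _))
    -- The sum for `a` is the sum for `suc a` without its term c = 0, which is therefore what
    -- survives.
    head-step (suc a) i β =
      trans (cong₂ _-_ (hconv-∷ F i (suc a) β)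
                       (trans (cong (λ z → hconv F z (a ∷ β)) (ℤP.+-identityʳ i)) (hconv-∷ F i a β)))
            (cancel (hconv (λ i β → F i (suc a ∷ β)) i β) _)

  -- The reflection `flip` and the symmetry deduced from it.

  self-negative⇒0 : ∀ i → i ≡ - i → i ≡ 0ℤ
  self-negative⇒0 (+ zero)   _  = refl

  shift-invariant⇒constant : (f : ℤ → ℤ) → (∀ k → f (k - 1ℤ) ≡ f k) → ∀ k → f k ≡ f 0ℤ
  shift-invariant⇒constant f inv (+ zero)       = refl
  shift-invariant⇒constant f inv (+ suc n)      = trans (sym (inv (+ suc n))) (shift-invariant⇒constant f inv (+ n))
  shift-invariant⇒constant f inv (-[1+ zero ])  = inv 0ℤ
  shift-invariant⇒constant f inv (-[1+ suc n ]) =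
    trans (cong (λ m → f (-[1+ suc m ])) (sym (ℕP.+-identityʳ n))) (trans (inv -[1+ n ]) (shift-invariant⇒constant f inv -[1+ n ]))

  module _ {N : ℕ} where

    -- The substitution t ↦ 1/t, x_u ↦ t^l x_u.
    flip : ℕ → Series N → Series N
    flip l F k α = F (+ (l ℕ.* V.sum α) - k) α

    flip-cong : ∀ l {F G} → F ≈ G → flip l F ≈ flip l G
    flip-cong l p = pointwise λ k α → at p (+ (l ℕ.* V.sum α) - k) α

    flip-sh : ∀ l d F → flip l (sh d F) ≈ sh (- d) (flip l F)
    flip-sh l d F = pointwise λ k α → cong (λ i → F i α) (lemma (+ (l ℕ.* V.sum α)) k d)
      where
      lemma : ∀ a k d → a - k - d ≡ a - (k - - d)
      lemma = solve-∀

    -- The substitution turns 1 - t^d x_u into 1 - t^(-d) t^l x_u, so the exponents d and l - d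
    -- change places; in particular the products for 0 and l are exchanged.
    flip-y : ∀ d e {l} → d ℕ.+ e ≡ l → ∀ u F → flip l (y d u F) ≈ y e u (flip l F)
    flip-y d e refl u F = pointwise λ k α → cong (λ z → flip (d ℕ.+ e) F k α - z) (pt k α)
      where
      l = d ℕ.+ e
      lemma : ∀ l m k d e → l ≡ d + e → l + m - k - d ≡ m - (k - e)
      lemma _ m k d e refl = lem m k d e
        where
        lem : ∀ m k d e → d + e + m - k - d ≡ m - (k - e)
        lem = solve-∀
      pt : ∀ k α → X u (sh (+ d) F) (+ (l ℕ.* V.sum α) - k) α ≡ X u (sh (+ e) (flip l F)) k α
      pt k α with dec u α in eq
      ... | nothing = refl
      ... | just β  = cong (λ i → F i β)
        (trans (cong (λ i → i - k - + d)
                 (trans (cong (λ m → + (l ℕ.* m)) (trans (cong V.sum (dec⇒inc u α eq)) (sum-inc u β)))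
                 (trans (cong +_ (ℕP.*-suc l (V.sum β))) (ℤP.pos-+ l _))))
               (lemma (+ l) (+ (l ℕ.* V.sum β)) k (+ d) (+ e) (ℤP.pos-+ d e)))

    flip-B : ∀ d e {l} → d ℕ.+ e ≡ l → ∀ {n} (ι : Fin n → Fin N) F → flip l (B d ι F) ≈ B e ι (flip l F)
    flip-B d e p {zero}  ι F = ≈-refl
    flip-B d e p {suc n} ι F = ≈-trans (flip-y d e p (ι zero) (B d (ι ∘ suc) F)) (y-cong e (ι zero) (flip-B d e p (ι ∘ suc) F))

  -- These four relations are all that the combinatorics supplies. `transfer` is W (H′ - t H) = (1 -
  -- t) H′ without denominators; both of its sides have the shape F - t F - W, with F = W and F = 1,
  -- as they are the two ends of one chain of recurrences.
  module Symmetry {N : ℕ} (l : ℕ) (δ Q W G : Series N)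
    (flip-δ : flip l δ ≈ δ)
    (Q-G : B 0 id Q ≈ G)
    (W-G : B l id W ≈ G)
    (transfer : B l id (W ⊝ sh 1ℤ W ⊝ W) ≈ B 0 id (δ ⊝ sh 1ℤ δ ⊝ W))
    where

    P P′ : Series N → Series N
    P  = B 0 id
    P′ = B l id

    P′P : ∀ F → P′ (P F) ≈ P (P′ F)
    P′P F = B-comm l id 0 id F

    flip-P : ∀ F → flip l (P F) ≈ P′ (flip l F)
    flip-P = flip-B 0 l refl id

    flip-P′ : ∀ F → flip l (P′ F) ≈ P (flip l F)
    flip-P′ = flip-B l 0 (ℕP.+-identityʳ l) id

    c : Series N
    c = P′ (P δ)

    flip-c : flip l c ≈ c
    flip-c = ≈-trans (flip-P′ (P δ)) (≈-trans (B-cong 0 id (≈-trans (flip-P δ) (B-cong l id flip-δ))) (≈-sym (P′P δ)))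

    B-⊝-sh : ∀ d (F H : Series N) → B d id (F ⊝ sh 1ℤ F ⊝ H) ≈ B d id F ⊝ sh 1ℤ (B d id F) ⊝ B d id H
    B-⊝-sh d F H = ≈-trans (B-⊝ d id (F ⊝ sh 1ℤ F) H)
      (⊝-cong (≈-trans (B-⊝ d id F (sh 1ℤ F)) (⊝-cong (≈-refl {F = B d id F}) (B-sh d id 1ℤ F))) (≈-refl {F = B d id H}))

    -- On the left of `transfer` the two copies of `W` cancel, and `W-G` turns what remains into -t
    -- G.
    TG : sh 1ℤ G ≈ P W ⊝ (P δ ⊝ sh 1ℤ (P δ))
    TG = pointwise λ k α → lemma (G k α) (G (k - 1ℤ) α) (P W k α) (P δ k α - P δ (k - 1ℤ) α)
      (trans (sym (cong₂ _-_ (cong₂ _-_ (at W-G k α) (at W-G (k - 1ℤ) α)) (at W-G k α)))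
      (trans (sym (at (B-⊝-sh l W W) k α)) (trans (at transfer k α) (at (B-⊝-sh 0 δ W) k α))))
      where
      lemma : ∀ g h w d → g - h - g ≡ d - w → h ≡ w - d
      lemma g h w d p = trans (lem₁ g h) (trans (cong -_ p) (lem₂ w d))
        where
        lem₁ : ∀ g h → h ≡ - (g - h - g)
        lem₁ = solve-∀
        lem₂ : ∀ w d → - (d - w) ≡ w - d
        lem₂ = solve-∀

    -- A further product `P′` turns `P W` into `P G`, so that only `G` is left. This is G (H′ - t H)
    -- = 1 - t multiplied by `c`.
    P′G-PG : sh 1ℤ (P′ G) ≈ P G ⊝ (c ⊝ sh 1ℤ c)
    P′G-PG =
      ≈-trans (≈-sym (B-sh l id 1ℤ G))
     (≈-trans (B-cong l id TG)
     (≈-trans (B-⊝ l id (P W) (P δ ⊝ sh 1ℤ (P δ)))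
     (⊝-cong (≈-trans (P′P W) (B-cong 0 id W-G))
             (≈-trans (B-⊝ l id (P δ) (sh 1ℤ (P δ))) (⊝-cong (≈-refl {F = c}) (B-sh l id 1ℤ (P δ)))))))

    -- Reflecting `P′G-PG` exchanges `P` and `P′` and inverts t; multiplied by t, the relation
    -- regains its old form. So `G` and its reflection solve the same equation.
    flip-P′G-PG : sh 1ℤ (P′ (flip l G)) ≈ P (flip l G) ⊝ (c ⊝ sh 1ℤ c)
    flip-P′G-PG = pointwise λ k α → rearrange _ _ (c (k - 1ℤ) α) (c k α)
      (trans (sym (at (flip-P′ G) k α))
      (trans (cong (λ i → P′ G i α) (sym (idx (+ (l ℕ.* V.sum α)) k)))
      (trans (at P′G-PG (+ (l ℕ.* V.sum α) - (k - 1ℤ)) α)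
      (cong₂ _-_ (at (flip-P G) (k - 1ℤ) α)
                 (cong₂ _-_ (at flip-c (k - 1ℤ) α)
                            (trans (cong (λ i → c i α) (idx (+ (l ℕ.* V.sum α)) k)) (at flip-c k α)))))))
      where
      idx : ∀ a k → a - (k - 1ℤ) - 1ℤ ≡ a - k
      idx = solve-∀
      rearrange : ∀ h g c d → h ≡ g - (c - d) → g ≡ h - (d - c)
      rearrange h g c d p = trans (lem g c d) (cong (λ z → z - (d - c)) (sym p))
        where
        lem : ∀ g c d → g ≡ g - (c - d) - (d - c)
        lem = solve-∀

    -- D = G - flip G satisfies (P - t P′) D = 0. At a lowest nonzero α this makes D constant in k,
    -- and D is antisymmetric under flip.
    G-symmetric : flip l G ≈ G
    G-symmetric = pointwise λ k α → sym (ℤP.i-j≡0⇒i≡j _ _ (vanishing step k α))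
      where
      D : Series N
      D = G ⊝ flip l G
      cancel : ∀ a b c → a - c - (b - c) ≡ a - b
      cancel = solve-∀
      D-recurrence : sh 1ℤ (P′ D) ≈ P D
      D-recurrence = pointwise λ k α →
        trans (at (B-⊝ l id G (flip l G)) (k - 1ℤ) α)
       (trans (cong₂ _-_ (at P′G-PG k α) (at flip-P′G-PG k α))
       (trans (cancel (P G k α) (P (flip l G) k α) (c k α - c (k - 1ℤ) α))
              (sym (at (B-⊝ 0 id G (flip l G)) k α))))
      antisymmetric : ∀ k α → D (+ (l ℕ.* V.sum α) - k) α ≡ - D k α
      antisymmetric k α =
        trans (cong (λ i → G (a - k) α - G i α) (lem a k)) (neg (G (a - k) α) (G k α))
        where
        a = + (l ℕ.* V.sum α)
        lem : ∀ a k → a - (a - k) ≡ k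
        lem = solve-∀
        neg : ∀ x y → x - y ≡ - (y - x)
        neg = solve-∀
      step : ∀ m → VanishesBelow m D → ∀ k α → V.sum α ≡ m → D k α ≡ 0ℤ
      step m van k α α≡m = trans (const k) (self-negative⇒0 _
        (trans (sym (const (+ (l ℕ.* V.sum α) - 0ℤ))) (antisymmetric 0ℤ α)))
        where
        lowest : ∀ d k → B d id D k α ≡ D k α
        lowest d k = B-lowest d id van k α (ℕP.≤-reflexive α≡m)
        const : ∀ k → D k α ≡ D 0ℤ α
        const = shift-invariant⇒constant (λ i → D i α) λ i →
          trans (sym (lowest l (i - 1ℤ))) (trans (at D-recurrence i α) (lowest 0 i))

    -- Subtracting `δ` removes the empty ornament: in degree n this deletes the summand i = n and
    -- leaves the sum over i < n.
    H S : Series N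
    H = hconv δ
    S = hconv (Q ⊝ δ)

    -- Since `Q` is already H G, the series `S` contains H squared and its reflection H′ squared;
    -- two copies of each product clear both.
    Ω : Series N → Series N
    Ω F = P′ (P′ (P (P F)))

    Ω-⊝ : ∀ F K → Ω (F ⊝ K) ≈ Ω F ⊝ Ω K
    Ω-⊝ F K =
      ≈-trans (B-cong l id (B-cong l id (≈-trans (B-cong 0 id (B-⊝ 0 id F K)) (B-⊝ 0 id (P F) (P K)))))
     (≈-trans (B-cong l id (B-⊝ l id (P (P F)) (P (P K)))) (B-⊝ l id (P′ (P (P F))) (P′ (P (P K)))))

    Ω-sh : ∀ F → Ω (sh 1ℤ F) ≈ sh 1ℤ (Ω F)
    Ω-sh F =
      ≈-trans (B-cong l id (B-cong l id (≈-trans (B-cong 0 id (B-sh 0 id 1ℤ F)) (B-sh 0 id 1ℤ (P F)))))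
     (≈-trans (B-cong l id (B-sh l id 1ℤ (P (P F)))) (B-sh l id 1ℤ (P′ (P (P F)))))

    Ω-flip : ∀ F → Ω (flip l F) ≈ flip l (Ω F)
    Ω-flip F = ≈-sym
     (≈-trans (flip-P′ (P′ (P (P F))))
     (≈-trans (B-cong 0 id (≈-trans (flip-P′ (P (P F))) (B-cong 0 id (≈-trans (flip-P (P F)) (B-cong l id (flip-P F))))))
              swap))
      where
      swap : ∀ {F} → P (P (P′ (P′ F))) ≈ Ω F
      swap {F} = ≈-trans (B-cong 0 id (≈-sym (P′P (P′ F))))
                (≈-trans (≈-sym (P′P (P (P′ F)))) (B-cong l id (≈-trans (B-cong 0 id (≈-sym (P′P F))) (≈-sym (P′P (P F))))))

    Ω-S : Ω S ≈ P′ (P′ G) ⊝ P′ c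
    Ω-S = ≈-trans (B-cong l id (B-cong l id PPS))
         (≈-trans (B-cong l id (B-⊝ l id G (P δ))) (B-⊝ l id (P′ G) c))
      where
      PPS : P (P S) ≈ G ⊝ P δ
      PPS = ≈-trans (B-cong 0 id (B-hconv (Q ⊝ δ))) (≈-trans (B-⊝ 0 id Q δ) (⊝-cong Q-G (≈-refl {F = P δ})))

    Ω-H : Ω H ≈ P′ c
    Ω-H = B-cong l id (B-cong l id (B-cong 0 id (B-hconv δ)))

    flip-P′P′G : flip l (P′ (P′ G)) ≈ P (P G)
    flip-P′P′G = ≈-trans (flip-P′ (P′ G)) (B-cong 0 id (≈-trans (flip-P′ G) (B-cong 0 id G-symmetric)))

    flip-P′c : flip l (P′ c) ≈ P c
    flip-P′c = ≈-trans (flip-P′ c) (B-cong 0 id flip-c)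

    B-P′G-PG : ∀ d → sh 1ℤ (B d id (P′ G)) ≈ B d id (P G) ⊝ (B d id c ⊝ sh 1ℤ (B d id c))
    B-P′G-PG d = ≈-trans (≈-sym (B-sh d id 1ℤ (P′ G)))
      (≈-trans (B-cong d id P′G-PG)
      (≈-trans (B-⊝ d id (P G) (c ⊝ sh 1ℤ c))
      (⊝-cong (≈-refl {F = B d id (P G)})
              (≈-trans (B-⊝ d id c (sh 1ℤ c)) (⊝-cong (≈-refl {F = B d id c}) (B-sh d id 1ℤ c))))))

    -- Multiplied by t, the left side contains ((t H)^2 - H′^2) G, a difference of squares. The
    -- relation G (H′ - t H) = 1 - t reduces it to -(1 - t)(t H + H′), free of G.
    S-difference : sh 1ℤ S ⊝ flip l (sh 1ℤ S) ≈ flip l H ⊝ H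
    S-difference = pointwise λ k α → ℤP.i-j≡0⇒i≡j _ _ (B-injective 0 id (B-injective 0 id
      (B-injective l id (B-injective l id Ω-zero))) k α)
      where
      Δ : Series N
      Δ = sh 1ℤ S ⊝ flip l (sh 1ℤ S) ⊝ (flip l H ⊝ H)
      ΩTS : Ω (sh 1ℤ S) ≈ sh 1ℤ (P′ (P′ G)) ⊝ sh 1ℤ (P′ c)
      ΩTS = ≈-trans (Ω-sh S) (sh-cong 1ℤ Ω-S)
      ΩFTS : Ω (flip l (sh 1ℤ S)) ≈ sh -1ℤ (P (P G)) ⊝ sh -1ℤ (P c)
      ΩFTS = ≈-trans (Ω-flip (sh 1ℤ S)) (≈-trans (flip-cong l (Ω-sh S))
        (≈-trans (flip-sh l 1ℤ (Ω S)) (sh-cong -1ℤ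
          (≈-trans (flip-cong l Ω-S) (⊝-cong flip-P′P′G flip-P′c)))))
      ΩFH : Ω (flip l H) ≈ P c
      ΩFH = ≈-trans (Ω-flip H) (≈-trans (flip-cong l Ω-H) flip-P′c)
      back : ∀ k → k + 1ℤ - 1ℤ ≡ k
      back = solve-∀
      algebra : ∀ {p′b p′c₁ pa pc₁ pc p′c b} → p′b ≡ b - (p′c - p′c₁) → b ≡ pa - (pc₁ - pc) →
                p′b - p′c₁ - (pa - pc₁) - (pc - p′c) ≡ 0ℤ
      algebra {p′c₁ = p′c₁} {pa} {pc₁} {pc} {p′c} refl refl = lem p′c₁ pa pc₁ pc p′c
        where
        lem : ∀ p′c₁ pa pc₁ pc p′c → pa - (pc₁ - pc) - (p′c - p′c₁) - p′c₁ - (pa - pc₁) - (pc - p′c) ≡ 0ℤ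
        lem = solve-∀
      Ω-zero : ∀ k α → B l id (B l id (B 0 id (B 0 id Δ))) k α ≡ 0ℤ
      Ω-zero k α =
        trans (at (Ω-⊝ (sh 1ℤ S ⊝ flip l (sh 1ℤ S)) (flip l H ⊝ H)) k α)
       (trans (cong₂ _-_ (trans (at (Ω-⊝ (sh 1ℤ S) (flip l (sh 1ℤ S))) k α) (cong₂ _-_ (at ΩTS k α) (at ΩFTS k α)))
                         (trans (at (Ω-⊝ (flip l H) H) k α) (cong₂ _-_ (at ΩFH k α) (at Ω-H k α))))
              -- The relation for `G` is used twice: from t `P′ P′ G` to `P P′ G`, and at exponent k
              -- + 1 from there to `P P G` divided by t.
              (algebra {p′c₁ = P′ c (k - 1ℤ) α} {P (P G) (k + 1ℤ) α} {P c (k + 1ℤ) α} {P c k α} {P′ c k α}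
                (trans (at (B-P′G-PG l) k α) (cong (λ z → z - (P′ c k α - P′ c (k - 1ℤ) α)) (at (P′P G) k α)))
                (trans (cong (λ i → P (P′ G) i α) (sym (back k))) (trans (at (B-P′G-PG 0) (k + 1ℤ) α)
                  (cong (λ i → P (P G) (k + 1ℤ) α - (P c (k + 1ℤ) α - P c i α)) (back k))))))

open FormalSeries

-- Words: common refinements, powers, commuting words.

module _ {A : Set} where

  -- Levi's lemma: the cases say which of the two cuts lies further to the right.
  ++-split : ∀ (u : List A) {v} p {s} → u ++ v ≡ p ++ s →
             (∃[ q ] u ≡ p ++ q × s ≡ q ++ v) ⊎ (∃[ q ] p ≡ u ++ q × v ≡ q ++ s)
  ++-split u       []      eq = inj₁ (u , refl , sym eq)
  ++-split []      (_ ∷ _) eq = inj₂ (_ , refl , eq)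
  ++-split (x ∷ u) (_ ∷ p) eq with LP.∷-injective eq
  ... | refl , eq′ with ++-split u p eq′
  ... | inj₁ (q , a , b) = inj₁ (q , cong (x ∷_) a , b)
  ... | inj₂ (q , a , b) = inj₂ (q , cong (x ∷_) a , b)

  ++-nonemptyˡ : ∀ {u v : List A} → u ≢ [] → u ++ v ≢ []
  ++-nonemptyˡ {[]}    u≢[] = ⊥-elim (u≢[] refl)
  ++-nonemptyˡ {x ∷ u} u≢[] = λ ()

  suffix-length : ∀ (u : List A) {v} → length v ℕ.≤ length (u ++ v)
  suffix-length u {v} = ℕP.≤-trans (ℕP.m≤n+m (length v) (length u)) (ℕP.≤-reflexive (sym (LP.length-++ u)))

  infixl 7 _^_
  _^_ : List A → ℕ → List A
  z ^ k = concat (replicate k z)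

  ^-+ : ∀ z i j → z ^ (i ℕ.+ j) ≡ z ^ i ++ z ^ j
  ^-+ z zero    j = refl
  ^-+ z (suc i) j = trans (cong (z ++_) (^-+ z i j)) (sym (LP.++-assoc z (z ^ i) (z ^ j)))

  ^-suc : ∀ z i → z ^ suc i ≡ z ^ i ++ z
  ^-suc z i = trans (cong (z ^_) (ℕP.+-comm 1 i)) (trans (^-+ z i 1) (cong (z ^ i ++_) (LP.++-identityʳ z)))

  CommonRoot : List A → List A → Set
  CommonRoot u v = ∃[ z ] ∃[ i ] ∃[ j ] u ≡ z ^ i × v ≡ z ^ j

  -- The Euclidean algorithm on words: cutting the shorter word off the longer leaves a commuting
  -- pair of smaller total length, which `n` bounds.
  commuting⇒powers : ∀ n (u v : List A) → length u ℕ.+ length v ℕ.≤ n → u ++ v ≡ v ++ u → CommonRoot u v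
  commuting⇒powers n       []      v       le eq = v , 0 , 1 , refl , sym (LP.++-identityʳ v)
  commuting⇒powers n       (x ∷ u) []      le eq = (x ∷ u) , 1 , 0 , sym (LP.++-identityʳ _) , refl
  commuting⇒powers (suc n) (x ∷ u) (y ∷ v) (s≤s le) eq with ++-split (x ∷ u) (y ∷ v) eq
  ... | inj₁ (q , refl , b) with commuting⇒powers n q (y ∷ v) bound (sym b)
    where
    bound : length q ℕ.+ suc (length v) ℕ.≤ n
    bound = ℕP.≤-trans (ℕP.+-monoˡ-≤ (suc (length v)) (suffix-length v)) le
  ... | z , i , j , a , b′ = z , j ℕ.+ i , j , trans (cong₂ _++_ b′ a) (sym (^-+ z j i)) , b′
  commuting⇒powers (suc n) (x ∷ u) (y ∷ v) (s≤s le) eq | inj₂ (q , refl , b)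
    with commuting⇒powers n (x ∷ u) q bound b
    where
    bound : suc (length u) ℕ.+ length q ℕ.≤ n
    bound = ℕP.≤-trans (ℕP.≤-reflexive (cong suc (sym (LP.length-++ u))))
                       (ℕP.≤-trans (ℕP.m≤n+m (suc (length (u ++ q))) (length u)) le)
  ... | z , i , j , a , b′ = z , i , i ℕ.+ j , a , trans (cong₂ _++_ a b′) (sym (^-+ z i j))

-- Lexicographic order, Lyndon words and the Chen-Fox-Lyndon factorization.

module Words {A : Set} (key : A → ℕ) (key-injective : ∀ {x y} → key x ≡ key y → x ≡ y) where

  infix 4 _≺_ _≼_

  data _≺_ : List A → List A → Set where
    end  : ∀ {y v} → [] ≺ y ∷ v
    this : ∀ {x y u v} → key x ℕ.< key y → x ∷ u ≺ y ∷ v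
    next : ∀ {x u v} → u ≺ v → x ∷ u ≺ x ∷ v

  _≼_ : List A → List A → Set
  u ≼ v = ¬ v ≺ u

  ≺-irrefl : ∀ {u} → ¬ u ≺ u
  ≺-irrefl (this x<x) = ℕP.<-irrefl refl x<x
  ≺-irrefl (next p)   = ≺-irrefl p

  ≺-trans : ∀ {u v w} → u ≺ v → v ≺ w → u ≺ w
  ≺-trans end      (this _) = end
  ≺-trans end      (next _) = end
  ≺-trans (this p) (this q) = this (ℕP.<-trans p q)
  ≺-trans (this p) (next q) = this p
  ≺-trans (next p) (this q) = this q
  ≺-trans (next p) (next q) = next (≺-trans p q)

  ≺-cmp : ∀ u v → Tri (u ≺ v) (u ≡ v) (v ≺ u)
  ≺-cmp []      []      = tri≈ (λ ()) refl (λ ())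
  ≺-cmp []      (_ ∷ _) = tri< end (λ ()) (λ ())
  ≺-cmp (_ ∷ _) []      = tri> (λ ()) (λ ()) end
  ≺-cmp (x ∷ u) (y ∷ v) with ℕP.<-cmp (key x) (key y)
  ... | tri< x<y _ _ = tri< (this x<y) (λ { refl → ℕP.<-irrefl refl x<y }) (λ q → ≺-irrefl (≺-trans (this {u = u} {v} x<y) q))
  ... | tri> _ _ x>y = tri> (λ q → ≺-irrefl (≺-trans (this {u = v} {u} x>y) q)) (λ { refl → ℕP.<-irrefl refl x>y }) (this x>y)
  ... | tri≈ _ x≈y _ with key-injective x≈y
  ... | refl with ≺-cmp u v
  ... | tri< a b c = tri< (next a) (λ { refl → ≺-irrefl a }) (λ q → ≺-irrefl (≺-trans (next a) q))
  ... | tri≈ a refl c = tri≈ ≺-irrefl refl ≺-irrefl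
  ... | tri> a b c = tri> (λ q → ≺-irrefl (≺-trans (next c) q)) (λ { refl → ≺-irrefl c }) (next c)

  ≼-refl : ∀ {u} → u ≼ u
  ≼-refl = ≺-irrefl

  ≺⇒≼ : ∀ {u v} → u ≺ v → u ≼ v
  ≺⇒≼ p q = ≺-irrefl (≺-trans p q)

  ≼⇒≺⊎≡ : ∀ {u v} → u ≼ v → u ≺ v ⊎ u ≡ v
  ≼⇒≺⊎≡ {u} {v} p with ≺-cmp u v
  ... | tri< a _ _ = inj₁ a
  ... | tri≈ _ b _ = inj₂ b
  ... | tri> _ _ c = ⊥-elim (p c)

  ≼-antisym : ∀ {u v} → u ≼ v → v ≼ u → u ≡ v
  ≼-antisym p q with ≼⇒≺⊎≡ p
  ... | inj₁ a = ⊥-elim (q a)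
  ... | inj₂ b = b

  ≼-≺-trans : ∀ {u v w} → u ≼ v → v ≺ w → u ≺ w
  ≼-≺-trans p q with ≼⇒≺⊎≡ p
  ... | inj₁ a    = ≺-trans a q
  ... | inj₂ refl = q

  ≼-trans : ∀ {u v w} → u ≼ v → v ≼ w → u ≼ w
  ≼-trans p q r = p (≼-≺-trans q r)

  ≼-++ʳ : ∀ u v → u ≼ u ++ v
  ≼-++ʳ (x ∷ u) v (this x<x) = ℕP.<-irrefl refl x<x
  ≼-++ʳ (x ∷ u) v (next p)   = ≼-++ʳ u v p

  ++⁺-≺ : ∀ p {u v} → u ≺ v → p ++ u ≺ p ++ v
  ++⁺-≺ []      q = q
  ++⁺-≺ (x ∷ p) q = next (++⁺-≺ p q)

  -- A word is smaller either as a proper prefix or by a differing letter; in the second case the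
  -- comparison survives any continuation of both words.
  ≺-prefix⊎mismatch : ∀ {u v} → u ≺ v → (∃[ v′ ] v ≡ u ++ v′ × v′ ≢ []) ⊎ (∀ a b → u ++ a ≺ v ++ b)
  ≺-prefix⊎mismatch end      = inj₁ (_ , refl , λ ())
  ≺-prefix⊎mismatch (this p) = inj₂ λ _ _ → this p
  ≺-prefix⊎mismatch (next p) with ≺-prefix⊎mismatch p
  ... | inj₁ (v′ , refl , ne) = inj₁ (v′ , refl , ne)
  ... | inj₂ m                = inj₂ λ a b → next (m a b)

  ≺-extend : ∀ {u v} → u ≺ v → length v ℕ.≤ length u → ∀ a b → u ++ a ≺ v ++ b
  ≺-extend (this p) le       a b = this p
  ≺-extend (next p) (s≤s le) a b = next (≺-extend p le a b)

  -- The suffix form suits concatenation and factorization. Its agreement with the necklace form, a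
  -- primitive word least among its rotations, is shown further down.
  Lyndon : List A → Set
  Lyndon w = w ≢ [] × (∀ u {v} → w ≡ u ++ v → u ≢ [] → v ≢ [] → w ≺ v)

  singleton-Lyndon : ∀ x → Lyndon (x ∷ [])
  singleton-Lyndon x = (λ ()) , split
    where
    split : ∀ u {v} → x ∷ [] ≡ u ++ v → u ≢ [] → v ≢ [] → x ∷ [] ≺ v
    split []                eq u≢[] v≢[] = ⊥-elim (u≢[] refl)
    split (_ ∷ [])    {[]} eq u≢[] v≢[] = ⊥-elim (v≢[] refl)

  -- The decisive suffix is `v` itself. If `v` is `u ++ v′`, then `v ≺ v′` because `v` is Lyndon,
  -- and prefixing `u` gives the claim; otherwise a letter decides.
  ++-Lyndon : ∀ {u v} → Lyndon u → Lyndon v → u ≺ v → Lyndon (u ++ v)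
  ++-Lyndon {u} {v} (u≢[] , lu) (v≢[] , lv) u≺v = ++-nonemptyˡ u≢[] , split
    where
    uv≺v : u ++ v ≺ v
    uv≺v with ≺-prefix⊎mismatch u≺v
    ... | inj₁ (v′ , refl , v′≢[]) = ++⁺-≺ u (lv u refl u≢[] v′≢[])
    ... | inj₂ m = subst (u ++ v ≺_) (LP.++-identityʳ v) (m v [])
    split : ∀ p {s} → u ++ v ≡ p ++ s → p ≢ [] → s ≢ [] → u ++ v ≺ s
    split p {s} eq p≢[] s≢[] with ++-split u p eq
    ... | inj₁ ([] , _ , refl) = uv≺v
    ... | inj₁ (q@(_ ∷ _) , refl , refl) = ≺-extend (lu p refl p≢[] (λ ())) (suffix-length p) v v
    ... | inj₂ ([] , _ , refl) = uv≺v
    ... | inj₂ (q@(_ ∷ _) , _ , v≡) = ≺-trans uv≺v (lv q v≡ (λ ()) s≢[])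

  -- A factorization lists its last factor first, so that it is nondecreasing, like the ornaments.
  flat : List (List A) → List A
  flat []      = []
  flat (r ∷ R) = flat R ++ r

  record Factorization (R : List (List A)) : Set where
    constructor factorization
    field
      sorted : AllPairs _≼_ R
      lyndon : All Lyndon R

  open Factorization public

  -- A nonempty suffix of `flat R` begins with a nonempty suffix of some factor. That is at least
  -- the Lyndon factor itself, hence at least `w`, and a continuation only increases it.
  suffix-≽ : ∀ {w} R → All Lyndon R → All (w ≼_) R → ∀ p {q} → flat R ≡ p ++ q → q ≢ [] → w ≼ q
  suffix-≽ []      _ _ p eq q≢[] = ⊥-elim (q≢[] (LP.++-conicalʳ p _ (sym eq)))
  suffix-≽ (r ∷ R) ((r≢[] , lr) ∷ ls) (w≼r ∷ ws) p {q} eq q≢[] with ++-split (flat R) p eq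
  ... | inj₁ ([] , a , refl) = w≼r
  ... | inj₁ (s@(_ ∷ _) , a , refl) = ≼-trans (suffix-≽ R ls ws p a (λ ())) (≼-++ʳ s r)
  ... | inj₂ ([] , a , refl) = w≼r
  ... | inj₂ (s@(_ ∷ _) , a , b) = ≼-trans w≼r (≺⇒≼ (lr s b (λ ()) q≢[]))

  private
    -- Otherwise `q ≼ r′ ≺ r`, whereas `q`, a suffix of `flat R`, is at least `r`. So the last
    -- factor is the longest Lyndon suffix, which makes factorizations unique.
    no-longer-factor : ∀ {r r′ R q} → Factorization (r ∷ R) → Lyndon r′ → ∀ p → flat R ≡ p ++ q → q ≢ [] → r′ ≢ q ++ r
    no-longer-factor {r} {q = q} (factorization (r≼ ∷ _) ((r≢[] , _) ∷ ls)) (_ , lr′) p eq q≢[] refl =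
      suffix-≽ _ ls r≼ p eq q≢[] (≼-≺-trans (≼-++ʳ q r) (lr′ q refl q≢[] r≢[]))

  flat-injective : ∀ {R R′} → Factorization R → Factorization R′ → flat R ≡ flat R′ → R ≡ R′
  flat-injective {[]}    {[]}      _ _ _ = refl
  flat-injective {[]}    {r′ ∷ R′} _ (factorization _ ((ne , _) ∷ _)) eq = ⊥-elim (ne (LP.++-conicalʳ (flat R′) r′ (sym eq)))
  flat-injective {r ∷ R} {[]}      (factorization _ ((ne , _) ∷ _)) _ eq = ⊥-elim (ne (LP.++-conicalʳ (flat R) r eq))
  flat-injective {r ∷ R} {r′ ∷ R′} f@(factorization (_ ∷ s) (lr ∷ l)) f′@(factorization (_ ∷ s′) (lr′ ∷ l′)) eq
    with ++-split (flat R) (flat R′) eq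
  ... | inj₁ ([] , a , refl) = cong (r ∷_) (flat-injective (factorization s l) (factorization s′ l′) (trans a (LP.++-identityʳ _)))
  ... | inj₂ ([] , a , refl) = cong (r ∷_) (flat-injective (factorization s l) (factorization s′ l′) (sym (trans a (LP.++-identityʳ _))))
  ... | inj₁ (q@(_ ∷ _) , a , b) = ⊥-elim (no-longer-factor f lr′ (flat R′) a (λ ()) b)
  ... | inj₂ (q@(_ ∷ _) , a , b) = ⊥-elim (no-longer-factor f′ lr (flat R) a (λ ()) b)

  -- A Lyndon word appended on the right absorbs the preceding factor as long as that factor is
  -- strictly smaller; `++-Lyndon` keeps the result Lyndon. Letter by letter, this yields a
  -- factorization of every word.
  glue : List A → List (List A) → List (List A)
  glue w []      = w ∷ []
  glue w (r ∷ R) with ≺-cmp r w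
  ... | tri< _ _ _ = glue (r ++ w) R
  ... | tri≈ _ _ _ = w ∷ r ∷ R
  ... | tri> _ _ _ = w ∷ r ∷ R

  flat-glue : ∀ w R → flat (glue w R) ≡ flat R ++ w
  flat-glue w []      = refl
  flat-glue w (r ∷ R) with ≺-cmp r w
  ... | tri< _ _ _ = trans (flat-glue (r ++ w) R) (sym (LP.++-assoc (flat R) r w))
  ... | tri≈ _ _ _ = refl
  ... | tri> _ _ _ = refl

  cons-factorization : ∀ {w r R} → w ≼ r → Lyndon w → Factorization (r ∷ R) → Factorization (w ∷ r ∷ R)
  cons-factorization w≼r lw (factorization s@(r≼ ∷ _) l) = factorization ((w≼r ∷ All.map (≼-trans w≼r) r≼) ∷ s) (lw ∷ l)

  glue-factorization : ∀ w R → Lyndon w → Factorization R → Factorization (glue w R)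
  glue-factorization w []      lw f = factorization ([] ∷ []) (lw ∷ [])
  glue-factorization w (r ∷ R) lw f@(factorization (_ ∷ s) (lr ∷ l)) with ≺-cmp r w
  ... | tri< r≺w _ _ = glue-factorization (r ++ w) R (++-Lyndon lr lw r≺w) (factorization s l)
  ... | tri≈ w≼r _ _ = cons-factorization w≼r lw f
  ... | tri> w≼r _ _ = cons-factorization w≼r lw f

  factorFrom : List (List A) → List A → List (List A)
  factorFrom R []      = R
  factorFrom R (x ∷ w) = factorFrom (glue (x ∷ []) R) w

  factor : List A → List (List A)
  factor = factorFrom []

  factor-factorization : ∀ w → Factorization (factor w)
  factor-factorization = go (factorization [] [])
    where
    go : ∀ {R} → Factorization R → ∀ w → Factorization (factorFrom R w)
    go f []      = f
    go f (x ∷ w) = go (glue-factorization (x ∷ []) _ (singleton-Lyndon x) f) w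

  flat-factor : ∀ w → flat (factor w) ≡ w
  flat-factor = go []
    where
    go : ∀ R w → flat (factorFrom R w) ≡ flat R ++ w
    go R []      = sym (LP.++-identityʳ _)
    go R (x ∷ w) = trans (go (glue (x ∷ []) R) w) (trans (cong (_++ w) (flat-glue (x ∷ []) R)) (LP.++-assoc (flat R) (x ∷ []) w))

  factor-flat : ∀ {R} → Factorization R → factor (flat R) ≡ R
  factor-flat {R} f = flat-injective (factor-factorization (flat R)) f (flat-factor (flat R))

  Primitive : List A → Set
  Primitive w = ∀ z k → w ≢ z ^ suc (suc k)

  LeastRotation : List A → Set
  LeastRotation w = ∀ u {v} → w ≡ u ++ v → v ≢ [] → w ≼ v ++ u

  -- The root `z` of a proper power is a proper suffix, but as a prefix it cannot exceed the power.
  Lyndon⇒Primitive : ∀ {w} → Lyndon w → Primitive w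
  Lyndon⇒Primitive (w≢[] , lw) z k refl with z ≟[]
    where
    _≟[] : ∀ (z : List A) → Dec (z ≡ [])
    [] ≟[]      = yes refl
    (_ ∷ _) ≟[] = no λ ()
  ... | yes refl = w≢[] (powers-[] (suc (suc k)))
    where
    powers-[] : ∀ k → [] ^ k ≡ ([] {A = A})
    powers-[] zero    = refl
    powers-[] (suc k) = powers-[] k
  ... | no z≢[] = ≼-++ʳ z (z ^ suc k) (lw (z ^ suc k) (^-suc z (suc k)) (++-nonemptyˡ z≢[]) z≢[])

  -- `w` is longer than its suffix `v`, so `w ≺ v` is decided at a letter and persists when `u` is
  -- appended to `v`.
  Lyndon⇒LeastRotation : ∀ {w} → Lyndon w → LeastRotation w
  Lyndon⇒LeastRotation (w≢[] , lw) []      {v} refl v≢[] = subst (v ≼_) (sym (LP.++-identityʳ v)) ≼-refl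
  Lyndon⇒LeastRotation (w≢[] , lw) u@(_ ∷ _) {v} refl v≢[] with ≺-prefix⊎mismatch (lw u refl (λ ()) v≢[])
  ... | inj₁ (v′ , eq , _) = ⊥-elim (ℕP.<⇒≱ (s≤s (suffix-length (L.drop 1 u)))
          (ℕP.≤-trans (ℕP.m≤m+n (length (u ++ v)) (length v′)) (ℕP.≤-reflexive (trans (sym (LP.length-++ (u ++ v))) (cong length (sym eq))))))
  ... | inj₂ m = ≺⇒≼ (subst (_≺ v ++ u) (LP.++-identityʳ (u ++ v)) (m [] u))

  -- Suppose a suffix `v` were smaller than `w`. A deciding letter would make the rotation `v ++ u`
  -- smaller as well. If `v` is a prefix instead, then `w` is also `v ++ u′` with `u′` as long as
  -- `u`; minimality against both rotations forces `u ≡ u′`, so `u` and `v` commute and `w` is a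
  -- proper power.
  Primitive∧LeastRotation⇒Lyndon : ∀ {w} → w ≢ [] → Primitive w → LeastRotation w → Lyndon w
  Primitive∧LeastRotation⇒Lyndon {w} w≢[] prim least = w≢[] , split
    where
    split : ∀ u {v} → w ≡ u ++ v → u ≢ [] → v ≢ [] → w ≺ v
    split u {v} refl u≢[] v≢[] with ≺-cmp w v
    ... | tri< a _ _ = a
    ... | tri≈ _ b _ = ⊥-elim (u≢[] (LP.++-cancelʳ v u [] b))
    ... | tri> _ _ v≺w with ≺-prefix⊎mismatch v≺w
    ... | inj₂ m = ⊥-elim (least u refl v≢[] (subst (v ++ u ≺_) (LP.++-identityʳ (u ++ v)) (m u [])))
    ... | inj₁ (u′ , eq , u′≢[]) = ⊥-elim (not-commuting (subst (λ t → u ++ v ≡ v ++ t) (sym u≡u′) eq))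
      where
      lengths : length u ≡ length u′
      lengths = ℕP.+-cancelʳ-≡ (length v) (length u) (length u′)
        (trans (sym (LP.length-++ u)) (trans (cong length eq) (trans (LP.length-++ v) (ℕP.+-comm (length v) _))))
      u≡u′ : u ≡ u′
      u≡u′ = ≼-antisym
        (λ u′≺u → least v eq u′≢[] (≺-extend u′≺u (ℕP.≤-reflexive lengths) v v))
        (λ u≺u′ → least u refl v≢[] (subst (v ++ u ≺_) (sym eq) (++⁺-≺ v u≺u′)))
      not-commuting : u ++ v ≢ v ++ u
      not-commuting eq′ with commuting⇒powers _ u v ℕP.≤-refl eq′
      ... | z , zero  , j     , a    , b    = u≢[] a
      ... | z , suc i , zero  , a    , b    = v≢[] b
      ... | z , suc i , suc j , refl , refl = prim z (i ℕ.+ j)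
        (trans (sym (^-+ z (suc i) (suc j))) (cong (λ k → z ^ suc k) (ℕP.+-suc i j)))

  insert : List A → List (List A) → List (List A)
  insert w []      = w ∷ []
  insert w (r ∷ R) with ≺-cmp r w
  ... | tri< _ _ _ = r ∷ insert w R
  ... | tri≈ _ _ _ = w ∷ r ∷ R
  ... | tri> _ _ _ = w ∷ r ∷ R

  remove : List A → List (List A) → List (List A)
  remove w []      = []
  remove w (r ∷ R) with ≺-cmp r w
  ... | tri< _ _ _ = r ∷ remove w R
  ... | tri≈ _ _ _ = R
  ... | tri> _ _ _ = r ∷ remove w R

  insert-All : ∀ {P : List A → Set} {w} R → P w → All P R → All P (insert w R)
  insert-All []      p ps = p ∷ []
  insert-All {w = w} (r ∷ R) p (q ∷ ps) with ≺-cmp r w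
  ... | tri< _ _ _ = q ∷ insert-All R p ps
  ... | tri≈ _ _ _ = p ∷ q ∷ ps
  ... | tri> _ _ _ = p ∷ q ∷ ps

  remove-All : ∀ {P : List A → Set} {w} R → All P R → All P (remove w R)
  remove-All []      ps = []
  remove-All {w = w} (r ∷ R) (q ∷ ps) with ≺-cmp r w
  ... | tri< _ _ _ = q ∷ remove-All R ps
  ... | tri≈ _ _ _ = ps
  ... | tri> _ _ _ = q ∷ remove-All R ps

  insert-∈ : ∀ w R → w ∈ insert w R
  insert-∈ w []      = here refl
  insert-∈ w (r ∷ R) with ≺-cmp r w
  ... | tri< _ _ _ = there (insert-∈ w R)
  ... | tri≈ _ _ _ = here refl
  ... | tri> _ _ _ = here refl

  insert-factorization : ∀ {w} R → Lyndon w → Factorization R → Factorization (insert w R)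
  insert-factorization []      lw f = factorization ([] ∷ []) (lw ∷ [])
  insert-factorization {w} (r ∷ R) lw f@(factorization (r≼ ∷ s) (lr ∷ l)) with ≺-cmp r w
  ... | tri< r≺w _ _ with insert-factorization R lw (factorization s l)
  ... | factorization s′ l′ = factorization (insert-All R (≺⇒≼ r≺w) r≼ ∷ s′) (lr ∷ l′)
  insert-factorization (r ∷ R) lw f | tri≈ w≼r _ _ = cons-factorization w≼r lw f
  insert-factorization (r ∷ R) lw f | tri> w≼r _ _ = cons-factorization w≼r lw f

  remove-factorization : ∀ {w} R → Factorization R → Factorization (remove w R)
  remove-factorization []      f = f
  remove-factorization {w} (r ∷ R) (factorization (r≼ ∷ s) (lr ∷ l)) with ≺-cmp r w
  ... | tri≈ _ _ _ = factorization s l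
  ... | tri< _ _ _ with remove-factorization {w} R (factorization s l)
  ... | factorization s′ l′ = factorization (remove-All R r≼ ∷ s′) (lr ∷ l′)
  remove-factorization {w} (r ∷ R) (factorization (r≼ ∷ s) (lr ∷ l)) | tri> _ _ _ with remove-factorization {w} R (factorization s l)
  ... | factorization s′ l′ = factorization (remove-All R r≼ ∷ s′) (lr ∷ l′)

  remove-insert : ∀ w R → remove w (insert w R) ≡ R
  remove-insert w []      with ≺-cmp w w
  ... | tri< _ w≢w _ = ⊥-elim (w≢w refl)
  ... | tri≈ _ _ _   = refl
  ... | tri> _ w≢w _ = ⊥-elim (w≢w refl)
  remove-insert w (r ∷ R) with ≺-cmp r w in eq
  ... | tri< _ _ _ rewrite eq = cong (r ∷_) (remove-insert w R)
  ... | tri≈ _ refl _ rewrite eq = refl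
  ... | tri> _ _ _ with ≺-cmp w w
  ... | tri< _ w≢w _ = ⊥-elim (w≢w refl)
  ... | tri≈ _ _ _   = refl
  ... | tri> _ w≢w _ = ⊥-elim (w≢w refl)

  insert-least : ∀ w R → All (w ≼_) R → insert w R ≡ w ∷ R
  insert-least w []      _ = refl
  insert-least w (r ∷ R) (w≼r ∷ _) with ≺-cmp r w
  ... | tri< r≺w _ _ = ⊥-elim (w≼r r≺w)
  ... | tri≈ _ _ _   = refl
  ... | tri> _ _ _   = refl

  insert-remove : ∀ {w} R → AllPairs _≼_ R → w ∈ R → insert w (remove w R) ≡ R
  insert-remove {w} (r ∷ R) (r≼ ∷ s) w∈ with ≺-cmp r w in eq
  insert-remove {w} (.w ∷ R) (r≼ ∷ s) w∈ | tri≈ _ refl _ = insert-least w R r≼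
  insert-remove {w} (r ∷ R) (r≼ ∷ s) (here refl) | tri< _ r≢r _ = ⊥-elim (r≢r refl)
  insert-remove {w} (r ∷ R) (r≼ ∷ s) (there w∈) | tri< _ _ _ rewrite eq = cong (r ∷_) (insert-remove R s w∈)
  insert-remove {w} (r ∷ R) (r≼ ∷ s) (here refl) | tri> _ r≢r _ = ⊥-elim (r≢r refl)
  insert-remove {w} (r ∷ R) (r≼ ∷ s) (there w∈) | tri> _ _ w≺r = ⊥-elim (All.lookup r≼ w∈ w≺r)

  flat-insert-↭ : ∀ w R → flat (insert w R) ↭ w ++ flat R
  flat-insert-↭ w []      = ↭-reflexive (sym (LP.++-identityʳ w))
  flat-insert-↭ w (r ∷ R) with ≺-cmp r w
  ... | tri< _ _ _ = ↭-trans (++⁺ʳ r (flat-insert-↭ w R)) (↭-reflexive (LP.++-assoc w (flat R) r))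
  ... | tri≈ _ _ _ = ++-comm (flat R ++ r) w
  ... | tri> _ _ _ = ++-comm (flat R ++ r) w

  flat-↭-concat : ∀ R → flat R ↭ concat R
  flat-↭-concat []      = ↭-refl
  flat-↭-concat (r ∷ R) = ↭-trans (++-comm (flat R) r) (++⁺ˡ r (flat-↭-concat R))

-- The colored alphabet: conditions (1) and (2) on Lyndon words and at their junctions.

module Letters (l′ N : ℕ) where

  l : ℕ
  l = suc l′

  Lt : Set
  Lt = Letter l N

  val : Lt → Fin N
  val (unb u _) = u
  val (bar u)   = u

  -- The position of a letter within its block of l + 1 letters equals its contribution to the
  -- statistic, as the barred letter comes last and contributes l.
  key-decomposition : (x : Lt) → key x ≡ absv x ℕ.* suc l ℕ.+ letterStat x
  key-decomposition (unb u m) = refl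
  key-decomposition (bar u)   = refl

  letterStat≤l : (x : Lt) → letterStat x ℕ.≤ l
  letterStat≤l (unb u m) = ℕP.<⇒≤ (FP.toℕ<n m)
  letterStat≤l (bar u)   = ℕP.≤-refl

  absv-<⇒key-< : (x y : Lt) → absv x ℕ.< absv y → key x ℕ.< key y
  absv-<⇒key-< x y x<y = begin-strict
    key x                                 ≡⟨ key-decomposition x ⟩
    absv x ℕ.* suc l ℕ.+ letterStat x     ≤⟨ ℕP.+-monoʳ-≤ _ (letterStat≤l x) ⟩
    absv x ℕ.* suc l ℕ.+ l                <⟨ ℕP.+-monoʳ-< _ (ℕP.n<1+n l) ⟩
    absv x ℕ.* suc l ℕ.+ suc l            ≡⟨ ℕP.+-comm _ (suc l) ⟩
    suc (absv x) ℕ.* suc l                ≤⟨ ℕP.*-monoˡ-≤ (suc l) x<y ⟩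
    absv y ℕ.* suc l                      ≤⟨ ℕP.m≤m+n _ (letterStat y) ⟩
    absv y ℕ.* suc l ℕ.+ letterStat y     ≡⟨ key-decomposition y ⟨
    key y                                 ∎
    where open ℕP.≤-Reasoning

  key-≤⇒absv-≤ : (x y : Lt) → key x ℕ.≤ key y → absv x ℕ.≤ absv y
  key-≤⇒absv-≤ x y le with absv x ℕP.≤? absv y
  ... | yes p = p
  ... | no ¬p = ⊥-elim (ℕP.<⇒≱ (absv-<⇒key-< y x (ℕP.≰⇒> ¬p)) le)

  letter-ext : (x y : Lt) → absv x ≡ absv y → letterStat x ≡ letterStat y → x ≡ y
  letter-ext (unb u m) (unb v k) p q = cong₂ unb (FP.toℕ-injective p) (FP.toℕ-injective q)
  letter-ext (unb u m) (bar v)   p q = ⊥-elim (ℕP.<-irrefl q (FP.toℕ<n m))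
  letter-ext (bar u)   (unb v k) p q = ⊥-elim (ℕP.<-irrefl (sym q) (FP.toℕ<n k))
  letter-ext (bar u)   (bar v)   p q = cong bar (FP.toℕ-injective p)

  abstract
    key-injective : {x y : Lt} → key x ≡ key y → x ≡ y
    key-injective {x} {y} eq = letter-ext x y abs≡
      (ℕP.+-cancelˡ-≡ (absv x ℕ.* suc l) _ _
        (trans (sym (key-decomposition x)) (trans eq (trans (key-decomposition y) (cong (λ a → a ℕ.* suc l ℕ.+ letterStat y) (sym abs≡))))))
      where
      abs≡ : absv x ≡ absv y
      abs≡ = ℕP.≤-antisym (key-≤⇒absv-≤ x y (ℕP.≤-reflexive eq)) (key-≤⇒absv-≤ y x (ℕP.≤-reflexive (sym eq)))

  open Words (key {l} {N}) key-injective public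

  -- Unbarred letters only: a barred letter is 0-colored as well, but subject to the opposite
  -- condition.
  ZeroColored : Lt → Set
  ZeroColored x = ∃[ u ] x ≡ unb u zero

  zeroColored? : ∀ x → Dec (ZeroColored x)
  zeroColored? (unb u zero)    = yes (u , refl)
  zeroColored? (unb u (suc m)) = no λ { (_ , ()) }
  zeroColored? (bar u)         = no λ { (_ , ()) }

  Ok : Lt → Lt → Set
  Ok x y = T (okPair x y)

  okPair-refl : ∀ x → Ok x x
  okPair-refl (unb u zero)    = ℕP.≤⇒≤ᵇ (ℕP.≤-refl {toℕ u})
  okPair-refl (unb u (suc m)) = tt
  okPair-refl (bar u)         = ℕP.≤⇒≤ᵇ (ℕP.≤-refl {toℕ u})

  -- A positive color imposes nothing, and for a barred letter a weak descent of letters is one of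
  -- absolute values, as (1) asks.
  Ok-descent : ∀ {x y} → ¬ ZeroColored x → key y ℕ.≤ key x → Ok x y
  Ok-descent {unb u zero}    nz le = ⊥-elim (nz (u , refl))
  Ok-descent {unb u (suc m)} nz le = tt
  Ok-descent {bar u} {y}     nz le = ℕP.≤⇒≤ᵇ (key-≤⇒absv-≤ y (bar u) le)

  -- u^0 is the least letter of its block, so a comparison of absolute values already compares the
  -- letters.
  Ok-zero⇒≤ : ∀ {x y} → ZeroColored x → Ok x y → key x ℕ.≤ key y
  Ok-zero⇒≤ {y = y} (u , refl) ok = begin
    toℕ u ℕ.* suc l ℕ.+ 0             ≡⟨ ℕP.+-identityʳ _ ⟩
    toℕ u ℕ.* suc l                   ≤⟨ ℕP.*-monoˡ-≤ (suc l) (ℕP.≤ᵇ⇒≤ (toℕ u) (absv y) ok) ⟩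
    absv y ℕ.* suc l                  ≤⟨ ℕP.m≤m+n _ (letterStat y) ⟩
    absv y ℕ.* suc l ℕ.+ letterStat y ≡⟨ key-decomposition y ⟨
    key y                             ∎
    where open ℕP.≤-Reasoning

  -- The condition `E` on the last letter is left open: it serves as the end condition of a linear
  -- word, as the cyclic closing, and as the junction with a following factor.
  Chain : (Lt → Set) → List Lt → Set
  Chain E []          = ⊤
  Chain E (x ∷ [])    = E x
  Chain E (x ∷ y ∷ w) = Ok x y × Chain E (y ∷ w)

  Chain-map : ∀ {E E′} w → (∀ e q → w ≡ q ++ e ∷ [] → E e → E′ e) → Chain E w → Chain E′ w
  Chain-map []          h c       = tt
  Chain-map (x ∷ [])    h c       = h x [] refl c
  Chain-map (x ∷ y ∷ w) h (o , c) = o , Chain-map (y ∷ w) (λ e q eq → h e (x ∷ q) (cong (x ∷_) eq)) c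

  Chain-++⁺ : ∀ {E y w} u → Chain (λ e → Ok e y) u → Chain E (y ∷ w) → Chain E (u ++ y ∷ w)
  Chain-++⁺ []          c       d = d
  Chain-++⁺ (x ∷ [])    c       d = c , d
  Chain-++⁺ (x ∷ z ∷ u) (o , c) d = o , Chain-++⁺ (z ∷ u) c d

  Chain-++⁻ : ∀ {E y w} u → Chain E (u ++ y ∷ w) → Chain (λ e → Ok e y) u × Chain E (y ∷ w)
  Chain-++⁻ []          d       = tt , d
  Chain-++⁻ (x ∷ [])    (c , d) = c , d
  Chain-++⁻ (x ∷ z ∷ u) (o , c) with Chain-++⁻ (z ∷ u) c
  ... | a , b = (o , a) , b

  -- Linear form of the necklace conditions: a Lyndon word of length ≥ 2 ends in a letter larger than its
  -- first one, so closing it up cyclically only forbids a final u^0.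
  Good : List Lt → Set
  Good = Chain (λ x → ¬ ZeroColored x)

  CycOK : List Lt → Set
  CycOK w = T (cycOK w)

  CycOK⇔Chain : ∀ x w → CycOK (x ∷ w) ⇔ Chain (λ e → Ok e x) (x ∷ w)
  CycOK⇔Chain z w = mk⇔ (to z w) (from z w)
    where
    to : ∀ x w → T (all (uncurry okPair) (zip (x ∷ w) (w ++ z ∷ []))) → Chain (λ e → Ok e z) (x ∷ w)
    to x []      p = proj₁ (Equivalence.to BP.T-∧ p)
    to x (y ∷ w) p with Equivalence.to BP.T-∧ p
    ... | a , b = a , to y w b
    from : ∀ x w → Chain (λ e → Ok e z) (x ∷ w) → T (all (uncurry okPair) (zip (x ∷ w) (w ++ z ∷ [])))
    from x []      p       = Equivalence.from BP.T-∧ (p , tt)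
    from x (y ∷ w) (a , b) = Equivalence.from BP.T-∧ (a , from y w b)

  SingleZero : List Lt → Set
  SingleZero w = ∃[ u ] w ≡ unb u zero ∷ []

  -- A longer Lyndon word lies below its one-letter suffix. With equal first letters that suffix
  -- would be a prefix and thus smaller, so the letters differ.
  last≥first : ∀ {x w q e} → Lyndon (x ∷ w) → x ∷ w ≡ q ++ e ∷ [] → q ≡ [] ⊎ key x ℕ.< key e
  last≥first {q = []}    ly eq = inj₁ refl
  last≥first {q = z ∷ q} {e} (_ , ly) eq with ly (z ∷ q) {e ∷ []} eq (λ ()) (λ ())
  ... | this p = inj₂ p

  last≥first-≤ : ∀ {x w q e} → Lyndon (x ∷ w) → x ∷ w ≡ q ++ e ∷ [] → key x ℕ.≤ key e
  last≥first-≤ {q = q} ly eq with last≥first {q = q} ly eq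
  last≥first-≤ ly refl | inj₁ refl = ℕP.≤-refl
  ... | inj₂ p    = ℕP.<⇒≤ p

  Good⇒CycOK : ∀ {w} → Lyndon w → Good w → CycOK w × ¬ SingleZero w
  Good⇒CycOK {[]}    ly g = ⊥-elim (proj₁ ly refl)
  Good⇒CycOK {x ∷ w} ly g =
    Equivalence.from (CycOK⇔Chain x w)
      (Chain-map (x ∷ w) (λ e q eq nz → Ok-descent nz (last≥first-≤ {q = q} ly eq)) g) ,
    λ { (u , refl) → g (u , refl) }

  CycOK⇒Good : ∀ {w} → Lyndon w → CycOK w → ¬ SingleZero w → Good w
  CycOK⇒Good {[]}    ly c ns = tt
  CycOK⇒Good {x ∷ w} ly c ns =
    Chain-map (x ∷ w) nonzero (Equivalence.to (CycOK⇔Chain x w) c)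
    where
    nonzero : ∀ e q → x ∷ w ≡ q ++ e ∷ [] → Ok e x → ¬ ZeroColored e
    nonzero e q eq ok z with last≥first {q = q} ly eq
    nonzero e q refl ok (u , refl) | inj₁ refl = ns (u , refl)
    ... | inj₂ p = ℕP.<⇒≱ p (Ok-zero⇒≤ z ok)

  first-≼ : ∀ {x y u v} → x ∷ u ≼ y ∷ v → key x ℕ.≤ key y
  first-≼ {x} {y} p with key x ℕP.≤? key y
  ... | yes le = le
  ... | no ¬le = ⊥-elim (p (this (ℕP.≰⇒> ¬le)))

  last-of-++ : ∀ {A : Set} (u : List A) {v q e} → v ≢ [] → u ++ v ≡ q ++ e ∷ [] → ∃[ p ] v ≡ p ++ e ∷ []
  last-of-++ u {v} {q} v≢[] eq with ++-split u q eq
  ... | inj₂ (p , _ , b)          = p , b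
  ... | inj₁ ([] , _ , b)         = [] , sym b
  ... | inj₁ (_ ∷ [] , _ , b)     = ⊥-elim (v≢[] (sym (LP.∷-injectiveʳ b)))
  ... | inj₁ (_ ∷ _ ∷ _ , _ , b) with LP.∷-injectiveʳ b
  ... | ()

  -- The last letter of a factor is at least its first, and that is at least the first letter of the
  -- next factor, so junctions are weak descents.
  flat-Good : ∀ {R} → Factorization R → All Good R → Good (flat R)
  flat-Good {[]} f gs = tt
  flat-Good {[] ∷ R} (factorization _ ((ne , _) ∷ _)) (g ∷ gs) = ⊥-elim (ne refl)
  flat-Good {(y ∷ r) ∷ R} (factorization (r≼ ∷ s) (lr ∷ ls)) (g ∷ gs) =
    Chain-++⁺ (flat R) (Chain-map (flat R) (descent R r≼ ls) (flat-Good (factorization s ls) gs)) g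
    where
    descent : ∀ R → All (y ∷ r ≼_) R → All Lyndon R → ∀ e q → flat R ≡ q ++ e ∷ [] → ¬ ZeroColored e → Ok e y
    descent []      _ _ e q eq nz with q | eq
    ... | []    | ()
    ... | _ ∷ _ | ()
    descent ([] ∷ R) _ ((ne , _) ∷ _) e q eq nz = ⊥-elim (ne refl)
    descent ((f ∷ r′) ∷ R) (p ∷ _) (lr′ ∷ _) e q eq nz with last-of-++ (flat R) {q = q} (λ ()) eq
    ... | q′ , eq′ = Ok-descent nz (ℕP.≤-trans (first-≼ p) (last≥first-≤ {q = q′} lr′ eq′))

  -- Only a factor ending in u^0 is at stake. By (2) the next factor starts at least as high, but
  -- factors do not increase, so equality holds throughout.
  flat-Good⁻ : ∀ {R} → Factorization R → Good (flat R) → All Good R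
  flat-Good⁻ {[]} f g = []
  flat-Good⁻ {[] ∷ R} (factorization _ ((ne , _) ∷ _)) g = ⊥-elim (ne refl)
  flat-Good⁻ {(y ∷ r) ∷ R} (factorization (r≼ ∷ s) (lr ∷ ls)) g with Chain-++⁻ (flat R) g
  ... | c , g′ = g′ ∷ flat-Good⁻ (factorization s ls) (Chain-map (flat R) (nonzero R r≼ ls) c)
    where
    nonzero : ∀ R → All (y ∷ r ≼_) R → All Lyndon R → ∀ e q → flat R ≡ q ++ e ∷ [] → Ok e y → ¬ ZeroColored e
    nonzero []      _ _ e q eq ok z with q | eq
    ... | []    | ()
    ... | _ ∷ _ | ()
    nonzero ([] ∷ R) _ ((ne , _) ∷ _) e q eq ok z = ⊥-elim (ne refl)
    nonzero ((f ∷ r′) ∷ R) (p ∷ _) (lr′ ∷ _) e q eq ok z with last-of-++ (flat R) {q = q} (λ ()) eq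
    ... | q′ , eq′ with last≥first {q = q′} lr′ eq′
    ... | inj₂ f<e = ℕP.<⇒≱ f<e (ℕP.≤-trans (Ok-zero⇒≤ z ok) (first-≼ p))
    -- The factor is the single letter u^0. The next one starts with u^0 and is at most that word,
    -- so it is also a single u^0, which its own goodness excludes.
    nonzero ((.e ∷ .[]) ∷ R) (p ∷ _) _ e q eq ok z | .[] , refl | inj₁ refl
      with key-injective {y} {e} (ℕP.≤-antisym (first-≼ p) (Ok-zero⇒≤ z ok))
    ... | refl = single r p g′
      where
      single : ∀ r → y ∷ r ≼ y ∷ [] → Good (y ∷ r) → ⊥
      single []      _ g = g z
      single (_ ∷ _) p g = p (next end)

-- Finite counting by bijections.

concatMap-Unique : ∀ {A B : Set} {f : A → List B} {xs} → Unique xs → (∀ x → Unique (f x)) →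
                   (∀ {x y z} → z ∈ f x → z ∈ f y → x ≡ y) → Unique (concatMap f xs)
concatMap-Unique []         uf dis = []
concatMap-Unique {f = f} {x ∷ xs} (x∉ ∷ u) uf dis = UP.++⁺ (uf x) (concatMap-Unique u uf dis) disjoint
  where
  disjoint : ∀ {z} → z ∈ f x × z ∈ concatMap f xs → ⊥
  disjoint (a , b) with find (∈-concatMap⁻ f b)
  ... | y , y∈xs , z∈fy = All.lookup x∉ y∈xs (dis a z∈fy)

injection-length : ∀ {A B : Set} {xs : List A} {ys : List B} (f : A → B) → Unique xs → (∀ {x} → x ∈ xs → f x ∈ ys) →
                   (∀ {x x′} → x ∈ xs → x′ ∈ xs → f x ≡ f x′ → x ≡ x′) → length xs ℕ.≤ length ys
injection-length f [] into inj = z≤n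
injection-length {xs = x ∷ xs} f (x∉ ∷ u) into inj with ∈-∃++ (into (here refl))
... | ys₁ , ys₂ , refl = ℕP.≤-trans (s≤s (injection-length f u into′ λ a b → inj (there a) (there b)))
    (ℕP.≤-reflexive (trans (cong suc (LP.length-++ ys₁)) (trans (sym (ℕP.+-suc (length ys₁) (length ys₂))) (sym (LP.length-++ ys₁)))))
  where
  into′ : ∀ {x′} → x′ ∈ xs → f x′ ∈ ys₁ ++ ys₂
  into′ x′∈ with ∈-++⁻ ys₁ (into (there x′∈))
  ... | inj₁ a         = ∈-++⁺ˡ a
  ... | inj₂ (here eq) = ⊥-elim (All.lookup x∉ x′∈ (sym (inj (there x′∈) (here refl) eq)))
  ... | inj₂ (there b) = ∈-++⁺ʳ ys₁ b

bijection-length : ∀ {A B : Set} {xs : List A} {ys : List B} (f : A → B) (g : B → A) → Unique xs → Unique ys →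
                   (∀ {x} → x ∈ xs → f x ∈ ys × g (f x) ≡ x) → (∀ {y} → y ∈ ys → g y ∈ xs × f (g y) ≡ y) →
                   length xs ≡ length ys
bijection-length f g ux uy to from = ℕP.≤-antisym
  (injection-length f ux (proj₁ ∘ to) (λ a b eq → trans (sym (proj₂ (to a))) (trans (cong g eq) (proj₂ (to b)))))
  (injection-length g uy (proj₁ ∘ from) (λ a b eq → trans (sym (proj₂ (from a))) (trans (cong f eq) (proj₂ (from b)))))

filterᵇ-↭-length : ∀ {A : Set} (p : A → Bool) {xs ys : List A} → xs ↭ ys → length (filterᵇ p xs) ≡ length (filterᵇ p ys)
filterᵇ-↭-length p q = ↭-length (filter-↭ (λ x → T? (p x)) q)

filterᵇ-∷-true : ∀ {A : Set} (p : A → Bool) {x} {xs : List A} → T (p x) → length (filterᵇ p (x ∷ xs)) ≡ suc (length (filterᵇ p xs))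
filterᵇ-∷-true p h = cong length (LP.filter-accept (λ x → T? (p x)) h)

filterᵇ-∷-false : ∀ {A : Set} (p : A → Bool) {x} {xs : List A} → ¬ T (p x) → length (filterᵇ p (x ∷ xs)) ≡ length (filterᵇ p xs)
filterᵇ-∷-false p h = cong length (LP.filter-reject (λ x → T? (p x)) h)

filter-⊎-length : ∀ {A : Set} {P Q R : A → Set} (P? : Decidable P) (Q? : Decidable Q) (R? : Decidable R) →
                  (∀ {x} → R x → P x ⊎ Q x) → (∀ {x} → P x → R x) → (∀ {x} → Q x → R x) → (∀ {x} → P x → Q x → ⊥) →
                  ∀ xs → length (filter R? xs) ≡ length (filter P? xs) ℕ.+ length (filter Q? xs)
filter-⊎-length P? Q? R? split fromP fromQ disj = go
  where
  go : ∀ xs → length (filter R? xs) ≡ length (filter P? xs) ℕ.+ length (filter Q? xs)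
  go [] = refl
  go (x ∷ xs) with R? x | P? x | Q? x
  ... | yes r | yes p | yes q = ⊥-elim (disj p q)
  ... | yes r | yes p | no ¬q = cong suc (go xs)
  ... | yes r | no ¬p | yes q = trans (cong suc (go xs)) (sym (ℕP.+-suc _ _))
  ... | no ¬r | yes p | _     = ⊥-elim (¬r (fromP p))
  ... | no ¬r | no ¬p | yes q = ⊥-elim (¬r (fromQ q))
  ... | no ¬r | no ¬p | no ¬q = go xs
  ... | yes r | no ¬p | no ¬q with split r
  ... | inj₁ p = ⊥-elim (¬p p)
  ... | inj₂ q = ⊥-elim (¬q q)

inc-tabulate : ∀ {N} (u : Fin N) (f g : Fin N → ℕ) → f u ≡ suc (g u) → (∀ v → v ≢ u → f v ≡ g v) → tabulate f ≡ inc u (tabulate g)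
inc-tabulate zero    f g p q = cong₂ _∷_ p (VP.tabulate-cong (λ v → q (suc v) λ ()))
inc-tabulate (suc u) f g p q = cong₂ _∷_ (q zero λ ()) (inc-tabulate u (f ∘ suc) (g ∘ suc) p (λ v v≢u → q (suc v) (v≢u ∘ FP.suc-injective)))

sum-tabulate-0 : ∀ N → V.sum (tabulate {n = N} (λ _ → 0)) ≡ 0
sum-tabulate-0 zero    = refl
sum-tabulate-0 (suc N) = sum-tabulate-0 N

-- Generating series of sets of words.

module Counting (l′ N : ℕ) where

  open import Data.Integer using (ℤ; +_; -[1+_]; -_; _+_; _-_; 0ℤ; 1ℤ; -1ℤ)

  open Letters l′ N public

  letters-Unique : Unique (allLetters l N)
  letters-Unique = concatMap-Unique (UP.allFin⁺ N) unique-block same-value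
    where
    block : Fin N → List Lt
    block u = L.map (unb u) (allFin l) ++ bar u ∷ []
    val-block : ∀ {x u} → x ∈ block u → val x ≡ u
    val-block {x} {u} x∈ with ∈-++⁻ (L.map (unb u) (allFin l)) x∈
    ... | inj₂ (here refl) = refl
    ... | inj₁ a with ∈-map⁻ (unb u) a
    ... | _ , _ , refl = refl
    same-value : ∀ {u v x} → x ∈ block u → x ∈ block v → u ≡ v
    same-value a b = trans (sym (val-block a)) (val-block b)
    unique-block : ∀ u → Unique (block u)
    unique-block u = UP.++⁺ (UP.map⁺ (λ { refl → refl }) (UP.allFin⁺ l)) ([] ∷ []) disjoint
      where
      disjoint : ∀ {x} → x ∈ L.map (unb u) (allFin l) × x ∈ bar u ∷ [] → ⊥
      disjoint (a , here refl) with ∈-map⁻ (unb u) a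
      ... | _ , _ , ()

  ∈-letters : ∀ x → x ∈ allLetters l N
  ∈-letters (unb u m) = ∈-concatMap⁺ (λ u → L.map (unb u) (allFin l) ++ bar u ∷ [])
    (lose (∈-allFin u) (∈-++⁺ˡ (∈-map⁺ (unb u) (∈-allFin m))))
  ∈-letters (bar u)   = ∈-concatMap⁺ (λ u → L.map (unb u) (allFin l) ++ bar u ∷ [])
    (lose (∈-allFin u) (∈-++⁺ʳ (L.map (unb u) (allFin l)) (here refl)))

  words-Unique : ∀ s → Unique (allWords l N s)
  words-Unique zero    = [] ∷ []
  words-Unique (suc s) = concatMap-Unique letters-Unique (λ x → UP.map⁺ LP.∷-injectiveʳ (words-Unique s)) same-head
    where
    same-head : ∀ {x y w} → w ∈ L.map (x ∷_) (allWords l N s) → w ∈ L.map (y ∷_) (allWords l N s) → x ≡ y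
    same-head {x} {y} a b with ∈-map⁻ (x ∷_) a | ∈-map⁻ (y ∷_) b
    ... | _ , _ , refl | _ , _ , refl = refl

  ∈-words : ∀ w → w ∈ allWords l N (length w)
  ∈-words []      = here refl
  ∈-words (x ∷ w) = ∈-concatMap⁺ (λ x → L.map (x ∷_) (allWords l N (length w))) (lose (∈-letters x) (∈-map⁺ (x ∷_) (∈-words w)))

  words-length : ∀ s {w} → w ∈ allWords l N s → length w ≡ s
  words-length zero    (here refl) = refl
  words-length (suc s) w∈ with find (∈-concatMap⁻ (λ x → L.map (x ∷_) (allWords l N s)) {xs = allLetters l N} w∈)
  ... | x , _ , w∈′ with ∈-map⁻ (x ∷_) w∈′
  ... | _ , v∈ , refl = cong suc (words-length s v∈)

  stat : List Lt → ℕ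
  stat w = sum (L.map letterStat w)

  cont : List Lt → Vec ℕ N
  cont w = tabulate (λ u → length (filterᵇ (λ x → absv x ≡ᵇ toℕ u) w))

  stat-↭ : ∀ {w v} → w ↭ v → stat w ≡ stat v
  stat-↭ p = NLP.sum-↭ (PP.map⁺ letterStat p)

  cont-↭ : ∀ {w v} → w ↭ v → cont w ≡ cont v
  cont-↭ p = VP.tabulate-cong (λ u → filterᵇ-↭-length (λ x → absv x ≡ᵇ toℕ u) p)

  absv-val : ∀ x → absv x ≡ toℕ (val x)
  absv-val (unb u _) = refl
  absv-val (bar u)   = refl

  cont-∷ : ∀ x w → cont (x ∷ w) ≡ inc (val x) (cont w)
  cont-∷ x w = inc-tabulate (val x) _ _
    (filterᵇ-∷-true (λ z → absv z ≡ᵇ toℕ (val x)) {x} (ℕP.≡⇒≡ᵇ _ _ (absv-val x)))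
    (λ v v≢ → filterᵇ-∷-false (λ z → absv z ≡ᵇ toℕ v) {x} (λ h → v≢ (FP.toℕ-injective (trans (sym (ℕP.≡ᵇ⇒≡ _ _ h)) (absv-val x)))))

  sum-cont : ∀ w → V.sum (cont w) ≡ length w
  sum-cont []      = sum-tabulate-0 N
  sum-cont (x ∷ w) = trans (cong V.sum (cont-∷ x w)) (trans (sum-inc (val x) (cont w)) (cong suc (sum-cont w)))

  Hit : (List Lt → Set) → ℤ → Vec ℕ N → List Lt → Set
  Hit P k α w = P w × + stat w ≡ k × cont w ≡ α

  hit? : ∀ {P : List Lt → Set} → Decidable P → ∀ k α → Decidable (Hit P k α)
  hit? P? k α w = P? w ×-dec (+ stat w ℤ.≟ k ×-dec VP.≡-dec ℕ._≟_ (cont w) α)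

  -- Enumerating only words of length `V.sum α` loses nothing, since the content of a word
  -- determines its length.
  hits : ∀ {P : List Lt → Set} → Decidable P → ℤ → Vec ℕ N → List (List Lt)
  hits P? k α = filter (hit? P? k α) (allWords l N (V.sum α))

  abstract
    gf : ∀ {P : List Lt → Set} → Decidable P → Series N
    gf P? k α = + length (hits P? k α)

    gf-hits : ∀ {P : List Lt → Set} (P? : Decidable P) k α → gf P? k α ≡ + length (hits P? k α)
    gf-hits P? k α = refl

  module _ {P : List Lt → Set} (P? : Decidable P) {k : ℤ} {α : Vec ℕ N} where

    hits-Unique : Unique (hits P? k α)
    hits-Unique = UP.filter⁺ (hit? P? k α) (words-Unique (V.sum α))

    ∈-hits⁺ : ∀ {w} → Hit P k α w → w ∈ hits P? k α
    ∈-hits⁺ {w} h@(_ , _ , refl) = ∈-filter⁺ (hit? P? k α) (subst (λ s → w ∈ allWords l N s) (sym (sum-cont w)) (∈-words w)) h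

    ∈-hits⁻ : ∀ {w} → w ∈ hits P? k α → Hit P k α w
    ∈-hits⁻ w∈ = proj₂ (∈-filter⁻ (hit? P? k α) {xs = allWords l N (V.sum α)} w∈)

  via-hits : ∀ {P Q : List Lt → Set} (P? : Decidable P) (Q? : Decidable Q) k k′ α →
             length (hits P? k α) ≡ length (hits Q? k′ α) → gf P? k α ≡ gf Q? k′ α
  via-hits P? Q? k k′ α eq = trans (gf-hits P? k α) (trans (cong +_ eq) (sym (gf-hits Q? k′ α)))

  gf-cong : ∀ {P Q : List Lt → Set} (P? : Decidable P) (Q? : Decidable Q) →
            (∀ {w} → P w → Q w) → (∀ {w} → Q w → P w) → gf P? ≈ gf Q?
  gf-cong P? Q? to from = pointwise λ k α → via-hits P? Q? k k α (bijection-length id id (hits-Unique P? {k} {α}) (hits-Unique Q? {k} {α})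
    (λ w∈ → let p , h = ∈-hits⁻ P? {k} {α} w∈ in ∈-hits⁺ Q? (to p , h) , refl)
    (λ w∈ → let q , h = ∈-hits⁻ Q? {k} {α} w∈ in ∈-hits⁺ P? (from q , h) , refl))

  gf-⊎ : ∀ {P Q R : List Lt → Set} (P? : Decidable P) (Q? : Decidable Q) (R? : Decidable R) →
         (∀ {w} → R w → P w ⊎ Q w) → (∀ {w} → P w → R w) → (∀ {w} → Q w → R w) → (∀ {w} → P w → Q w → ⊥) →
         ∀ k α → gf R? k α ≡ gf P? k α + gf Q? k α
  gf-⊎ P? Q? R? split fromP fromQ disj k α = trans (gf-hits R? k α) (trans
    (cong +_ (filter-⊎-length (hit? P? k α) (hit? Q? k α) (hit? R? k α)
      (λ { (r , h) → Sum.map (_, h) (_, h) (split r) })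
      (λ { (p , h) → fromP p , h }) (λ { (q , h) → fromQ q , h }) (λ { (p , _) (q , _) → disj p q })
      (allWords l N (V.sum α))))
    (trans (ℤP.pos-+ (length (hits P? k α)) (length (hits Q? k α))) (sym (cong₂ _+_ (gf-hits P? k α) (gf-hits Q? k α)))))

  gf-⊥ : ∀ {P : List Lt → Set} (P? : Decidable P) → (∀ {w} → ¬ P w) → ∀ k α → gf P? k α ≡ 0ℤ
  gf-⊥ P? none k α = trans (gf-hits P? k α) (cong (+_ ∘ length) (LP.filter-none (hit? P? k α) (All.universal (λ w h → none (proj₁ h)) (allWords l N (V.sum α)))))

  -- The recurrences below come from bijections that add one letter, either in front of a word or as
  -- a one-letter factor. If x_u does not divide x^α, nothing can be hit, in accordance with the
  -- default value in `X`.
  gf-shift : ∀ {P Q : List Lt → Set} (P? : Decidable P) (Q? : Decidable Q) (d : ℕ) (u : Fin N) (f g : List Lt → List Lt) →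
             (∀ {w} → P w → Q (f w) × stat (f w) ≡ d ℕ.+ stat w × cont (f w) ≡ inc u (cont w) × g (f w) ≡ w) →
             (∀ {w} → Q w → P (g w) × f (g w) ≡ w) →
             gf Q? ≈ X u (sh (+ d) (gf P?))
  gf-shift {P} {Q} P? Q? d u f g to from = pointwise pt
    where
    add-sub : ∀ k d → d + (k - d) ≡ k
    add-sub = solve-∀
    sub-add : ∀ d s → s ≡ d + s - d
    sub-add = solve-∀
    pt : ∀ k α → gf Q? k α ≡ X u (sh (+ d) (gf P?)) k α
    pt k α with dec u α in eq
    ... | nothing = trans (gf-hits Q? k α) (cong +_ (empty (hits Q? k α) λ w∈ → absurd (∈-hits⁻ Q? {k} {α} w∈)))
      where
      empty : ∀ {A : Set} (xs : List A) → (∀ {x} → x ∈ xs → ⊥) → length xs ≡ 0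
      empty []      _ = refl
      empty (x ∷ _) h = ⊥-elim (h (here refl))
      absurd : ∀ {w} → Hit Q k α w → ⊥
      absurd {w} (q , _ , refl) with from q
      ... | p , fg with to p
      ... | _ , _ , c , _ with trans (sym eq) (trans (cong (dec u) (trans (cong cont (sym fg)) c)) (dec-inc u (cont (g w))))
      ... | ()
    ... | just β = trans (gf-hits Q? k α) (trans (cong +_ (sym (bijection-length f g (hits-Unique P? {k - + d} {β}) (hits-Unique Q? {k} {α}) there′ back)))
                         (sym (gf-hits P? (k - + d) β)))
      where
      α≡ : α ≡ inc u β
      α≡ = dec⇒inc u α eq
      there′ : ∀ {w} → w ∈ hits P? (k - + d) β → f w ∈ hits Q? k α × g (f w) ≡ w
      there′ w∈ with ∈-hits⁻ P? {k - + d} {β} w∈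
      ... | p , s , c with to p
      ... | q , s′ , c′ , gf≡ = ∈-hits⁺ Q? (q ,
              trans (cong +_ s′) (trans (ℤP.pos-+ d _) (trans (cong (λ z → + d + z) s) (add-sub k (+ d)))) ,
              trans c′ (trans (cong (inc u) c) (sym α≡))) , gf≡
      back : ∀ {w} → w ∈ hits Q? k α → g w ∈ hits P? (k - + d) β × f (g w) ≡ w
      back {w} w∈ with ∈-hits⁻ Q? {k} {α} w∈
      ... | q , refl , c with from q
      ... | p , fg with to p
      ... | _ , s′ , c′ , _ = ∈-hits⁺ P? (p ,
              trans (sub-add (+ d) (+ stat (g w))) (cong (λ z → z - + d) (trans (sym (ℤP.pos-+ d _)) (cong +_ (trans (sym s′) (cong stat fg))))) ,
              just-injective (trans (sym (dec-inc u (cont (g w)))) (trans (cong (dec u) (trans (sym c′) (trans (cong cont fg) c))) eq))) , fg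

-- The recurrence on the absolute value of the first letter.

module Transfer (l′ N : ℕ) where

  open import Data.Integer using (ℤ; +_; -[1+_]; -_; _+_; _-_; 0ℤ; 1ℤ; -1ℤ)

  open Counting l′ N public

  chain? : ∀ {E : Lt → Set} → Decidable E → Decidable (Chain E)
  chain? E? []          = yes tt
  chain? E? (x ∷ [])    = E? x
  chain? E? (x ∷ y ∷ w) = T? (okPair x y) ×-dec chain? E? (y ∷ w)

  good? : Decidable Good
  good? = chain? (λ x → ¬? (zeroColored? x))

  -- The empty word counts as below every bound. This gives `R 0` the value `δ`, and it lets a good
  -- word end in bar u but not in u^0.
  HeadBelow : ℕ → List Lt → Set
  HeadBelow s []      = ⊤
  HeadBelow s (x ∷ _) = absv x ℕ.< s

  headBelow? : ∀ s → Decidable (HeadBelow s)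
  headBelow? s []      = yes tt
  headBelow? s (x ∷ _) = absv x ℕP.<? s

  Empty : List Lt → Set
  Empty w = w ≡ []

  empty? : Decidable Empty
  empty? []      = yes refl
  empty? (_ ∷ _) = no λ ()

  Starts : Lt → (List Lt → Set) → List Lt → Set
  Starts x P []      = ⊥
  Starts x P (y ∷ w) = y ≡ x × P w

  starts? : ∀ x {P : List Lt → Set} → Decidable P → Decidable (Starts x P)
  starts? x P? []      = no λ ()
  starts? x P? (y ∷ w) = (y ≟L x) ×-dec P? w

  gf-starts : ∀ x {P : List Lt → Set} (P? : Decidable P) → gf (starts? x P?) ≈ X (val x) (sh (+ letterStat x) (gf P?))
  gf-starts x P? = gf-shift P? (starts? x P?) (letterStat x) (val x) (x ∷_) (L.drop 1)
    (λ {w} p → (refl , p) , refl , cont-∷ x w , refl)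
    λ { {y ∷ w} (refl , p) → p , refl }

  W δ : Series N
  W = gf good?
  δ = gf empty?

  goodBelow? : ∀ s → Decidable (λ w → Good w × HeadBelow s w)
  goodBelow? s w = good? w ×-dec headBelow? s w

  goodAbove? : ∀ s → Decidable (λ w → Good w × ¬ HeadBelow s w)
  goodAbove? s w = good? w ×-dec ¬? (headBelow? s w)

  R : ℕ → Series N
  R s = gf (goodBelow? s)

  R-0 : R 0 ≈ δ
  R-0 = gf-cong (goodBelow? 0) empty? (λ { {[]} _ → refl ; {_ ∷ _} (_ , ()) }) (λ { refl → tt , tt })

  R-N : R N ≈ W
  R-N = gf-cong (goodBelow? N) good? proj₁ (λ {w} g → g , head-below w)
    where
    head-below : ∀ w → HeadBelow N w
    head-below []      = tt
    head-below (x ∷ _) = subst (ℕ._< N) (sym (absv-val x)) (FP.toℕ<n (val x))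

  above-W : ∀ s → gf (goodAbove? s) ≈ W ⊝ R s
  above-W s = pointwise λ k α → lemma (W k α) (R s k α) (gf (goodAbove? s) k α)
    (gf-⊎ (goodBelow? s) (goodAbove? s) good?
      (λ {w} g → split w g (headBelow? s w)) proj₁ proj₁ (λ { (_ , h) (_ , ¬h) → ¬h h }) k α)
    where
    split : ∀ w → Good w → Dec (HeadBelow s w) → (Good w × HeadBelow s w) ⊎ (Good w × ¬ HeadBelow s w)
    split w g (yes h) = inj₁ (g , h)
    split w g (no ¬h) = inj₂ (g , ¬h)
    lemma : ∀ w r a → w ≡ r + a → a ≡ w - r
    lemma w r a refl = lem r a
      where
      lem : ∀ r a → a ≡ r + a - r
      lem = solve-∀

  module Step (u : Fin N) where

    -- A first letter of positive color leaves the rest of the word free. The bound `j` admits the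
    -- colors one at a time, to build up a geometric sum in t.
    Colored : ℕ → List Lt → Set
    Colored j []              = ⊥
    Colored j (unb v m ∷ w)   = v ≡ u × (0 ℕ.< toℕ m × toℕ m ℕ.< j) × Good w
    Colored j (bar _ ∷ w)     = ⊥

    colored? : ∀ j → Decidable (Colored j)
    colored? j []            = no λ ()
    colored? j (unb v m ∷ w) = (v FP.≟ u) ×-dec ((0 ℕP.<? toℕ m ×-dec toℕ m ℕP.<? j) ×-dec good? w)
    colored? j (bar _ ∷ w)   = no λ ()

    D : ℕ → Series N
    D j = gf (colored? j)

    D-1 : ∀ k α → D 1 k α ≡ 0ℤ
    D-1 = gf-⊥ (colored? 1) λ { {unb v m ∷ w} (_ , (0<m , s≤s m≤0) , _) → ℕP.<⇒≱ 0<m m≤0 }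

    D-suc : ∀ i → suc i ℕ.< l → ∀ k α → D (suc (suc i)) k α ≡ D (suc i) k α + X u (sh (+ suc i) W) k α
    D-suc i i<l k α = trans
      (gf-⊎ (colored? (suc i)) (starts? x good?) (colored? (suc (suc i))) split grow last
        (λ { {unb v m ∷ w} (_ , (_ , m<i) , _) (refl , _) → ℕP.<-irrefl (FP.toℕ-fromℕ< i<l) m<i }) k α)
      (cong (λ z → D (suc i) k α + z)
        (trans (at (gf-starts x good?) k α) (cong (λ d → X u (sh (+ d) W) k α) (FP.toℕ-fromℕ< i<l))))
      where
      x : Lt
      x = unb u (fromℕ< i<l)
      split : ∀ {w} → Colored (suc (suc i)) w → Colored (suc i) w ⊎ Starts x Good w
      split {unb v m ∷ w} (refl , (0<m , s≤s m≤i) , g) with ℕP.m≤n⇒m<n∨m≡n m≤i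
      ... | inj₁ m<i = inj₁ (refl , (0<m , m<i) , g)
      ... | inj₂ m≡i = inj₂ (cong (unb u) (FP.toℕ-injective (trans m≡i (sym (FP.toℕ-fromℕ< i<l)))) , g)
      grow : ∀ {w} → Colored (suc i) w → Colored (suc (suc i)) w
      grow {unb v m ∷ w} (e , (0<m , m<i) , g) = e , (0<m , ℕP.m<n⇒m<1+n m<i) , g
      last : ∀ {w} → Starts x Good w → Colored (suc (suc i)) w
      last {unb v m ∷ w} (refl , g) = refl , (subst (0 ℕ.<_) (sym (FP.toℕ-fromℕ< i<l)) (s≤s z≤n) , subst (ℕ._< suc (suc i)) (sym (FP.toℕ-fromℕ< i<l)) ℕP.≤-refl) , g

    -- `D j` is (t + ... + t^(j-1)) x_u W; multiplication by 1 - t leaves its two ends.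
    D-telescope : ∀ i → suc i ℕ.≤ l → ∀ k α → D (suc i) k α - D (suc i) (k - 1ℤ) α ≡ X u (sh 1ℤ W) k α - X u (sh (+ suc i) W) k α
    D-telescope zero    _  k α = trans (cong₂ _-_ (D-1 k α) (D-1 (k - 1ℤ) α)) (sym (ℤP.+-inverseʳ (X u (sh 1ℤ W) k α)))
    D-telescope (suc i) le k α = trans (cong₂ _-_ (D-suc i le k α) (D-suc i le (k - 1ℤ) α))
      (trans (lemma (D (suc i) k α) (X u (sh (+ suc i) W) k α) (D (suc i) (k - 1ℤ) α) (X u (sh (+ suc i) W) (k - 1ℤ) α))
      (trans (cong₂ _+_ (D-telescope i (ℕP.<⇒≤ le) k α) (cong (λ z → X u (sh (+ suc i) W) k α - z) shift))
             (cancel (X u (sh 1ℤ W) k α) (X u (sh (+ suc i) W) k α) (X u (sh (+ suc (suc i)) W) k α))))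
      where
      lemma : ∀ a b c d → a + b - (c + d) ≡ a - c + (b - d)
      lemma = solve-∀
      cancel : ∀ a b c → a - b + (b - c) ≡ a - c
      cancel = solve-∀
      idx : ∀ k j → k - 1ℤ - j ≡ k - (1ℤ + j)
      idx = solve-∀
      shift : X u (sh (+ suc i) W) (k - 1ℤ) α ≡ X u (sh (+ suc (suc i)) W) k α
      shift = at (X-cong u {sh 1ℤ (sh (+ suc i) W)} (pointwise λ k β → cong (λ j → W j β) (idx k (+ suc i)))) k α

    s : ℕ
    s = toℕ u

    Fresh : List Lt → Set
    Fresh []      = ⊥
    Fresh (x ∷ w) = absv x ≡ s × Good (x ∷ w)

    fresh? : Decidable Fresh
    fresh? []      = no λ ()
    fresh? (x ∷ w) = (absv x ℕP.≟ s) ×-dec good? (x ∷ w)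

    low high : Lt
    low  = unb u zero
    high = bar u

    Low High : List Lt → Set
    Low  = Starts low (λ w → Good w × ¬ HeadBelow s w)
    High = Starts high (λ w → Good w × HeadBelow (suc s) w)

    low? : Decidable Low
    low? = starts? low (goodAbove? s)

    high? : Decidable High
    high? = starts? high (goodBelow? (suc s))

    R-suc : ∀ k α → R (suc s) k α ≡ R s k α + gf fresh? k α
    R-suc = gf-⊎ (goodBelow? s) fresh? (goodBelow? (suc s)) split
      (λ { {[]} h → h ; {_ ∷ _} (g , h) → g , ℕP.m<n⇒m<1+n h })
      (λ { {_ ∷ _} (e , g) → g , s≤s (ℕP.≤-reflexive e) })
      (λ { {_ ∷ _} (_ , h) (e , _) → ℕP.<-irrefl e h })
      where
      split : ∀ {w} → Good w × HeadBelow (suc s) w → (Good w × HeadBelow s w) ⊎ Fresh w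
      split {[]}    h = inj₁ h
      split {x ∷ w} (g , s≤s h) with ℕP.m≤n⇒m<n∨m≡n h
      ... | inj₁ a = inj₁ (g , a)
      ... | inj₂ b = inj₂ (b , g)

    Rest : List Lt → Set
    Rest w = Colored l w ⊎ High w

    rest? : Decidable Rest
    rest? w = colored? l w ⊎-dec high? w

    Good-low : ∀ w → Good (low ∷ w) → Good w × ¬ HeadBelow s w
    Good-low []      g       = ⊥-elim (g (u , refl))
    Good-low (y ∷ w) (o , g) = g , ℕP.≤⇒≯ (ℕP.≤ᵇ⇒≤ s (absv y) o)

    low-Good : ∀ w → Good w → ¬ HeadBelow s w → Good (low ∷ w)
    low-Good []      g ¬h = ⊥-elim (¬h tt)
    low-Good (y ∷ w) g ¬h = ℕP.≤⇒≤ᵇ (ℕP.≮⇒≥ ¬h) , g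

    Good-high : ∀ w → Good (high ∷ w) → Good w × HeadBelow (suc s) w
    Good-high []      g       = tt , tt
    Good-high (y ∷ w) (o , g) = g , s≤s (ℕP.≤ᵇ⇒≤ (absv y) s o)

    high-Good : ∀ w → Good w → HeadBelow (suc s) w → Good (high ∷ w)
    high-Good []      g h       = λ { (_ , ()) }
    high-Good (y ∷ w) g (s≤s h) = ℕP.≤⇒≤ᵇ h , g

    Good-colored : ∀ m w → Good (unb u (suc m) ∷ w) → Good w
    Good-colored m []      g       = tt
    Good-colored m (y ∷ w) (_ , g) = g

    colored-Good : ∀ m w → Good w → Good (unb u (suc m) ∷ w)
    colored-Good m []      g = λ { (_ , ()) }
    colored-Good m (y ∷ w) g = tt , g

    fresh-split : ∀ k α → gf fresh? k α ≡ gf low? k α + (D l k α + gf high? k α)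
    fresh-split k α = trans
      (gf-⊎ low? rest? fresh? split fromLow fromRest disjoint k α)
      (cong (λ z → gf low? k α + z) (gf-⊎ (colored? l) high? rest? id inj₁ inj₂ (λ { {bar _ ∷ _} () _ }) k α))
      where
      split : ∀ {w} → Fresh w → Low w ⊎ Rest w
      split {unb v m ∷ w} (e , g) with FP.toℕ-injective e
      split {unb v zero ∷ w} (e , g) | refl = inj₁ (refl , Good-low w g)
      split {unb v (suc m) ∷ w} (e , g) | refl = inj₂ (inj₁ (refl , (s≤s z≤n , FP.toℕ<n (suc m)) , Good-colored m w g))
      split {bar v ∷ w} (e , g) with FP.toℕ-injective e
      ... | refl = inj₂ (inj₂ (refl , Good-high w g))
      fromLow : ∀ {w} → Low w → Fresh w
      fromLow {_ ∷ w} (refl , g , ¬h) = refl , low-Good w g ¬h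
      fromRest : ∀ {w} → Rest w → Fresh w
      fromRest {unb v (suc m) ∷ w} (inj₁ (refl , _ , g)) = refl , colored-Good m w g
      fromRest {_ ∷ w} (inj₂ (refl , g , h)) = refl , high-Good w g h
      disjoint : ∀ {w} → Low w → Rest w → ⊥
      disjoint {_ ∷ w} (refl , _) (inj₁ (_ , (() , _) , _))
      disjoint {_ ∷ w} (refl , _) (inj₂ (() , _))

    sh-0 : ∀ F → X u (sh 0ℤ F) ≈ X u F
    sh-0 F = X-cong u (pointwise λ k β → cong (λ j → F j β) (ℤP.+-identityʳ k))

    -- The added words begin with u^0 before a word not below u, with u^m for 0 < m < l before any
    -- good word, or with bar u before a word below u + 1. The last kind brings `R (suc s)` back on
    -- the right.
    R-recurrence : ∀ k α → R (suc s) k α ≡ R s k α + (X u W k α - X u (R s) k α + (D l k α + X u (sh (+ l) (R (suc s))) k α))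
    R-recurrence k α = trans (R-suc k α) (cong (λ z → R s k α + z) (trans (fresh-split k α)
      (cong₂ (λ a b → a + (D l k α + b)) low≡ (at (gf-starts high (goodBelow? (suc s))) k α))))
      where
      low≡ : gf low? k α ≡ X u W k α - X u (R s) k α
      low≡ = trans (at (gf-starts low (goodAbove? s)) k α)
        (trans (at (sh-0 (gf (goodAbove? s))) k α) (trans (at (X-cong u (above-W s)) k α) (at (X-⊝ u W (R s)) k α)))

    -- R = W / (1 - t) is a constant solution of R-recurrence; E is (1 - t) times the deviation from it.
    E : ℕ → Series N
    E i = R i ⊝ sh 1ℤ (R i) ⊝ W

    X-E : ∀ i → X u (E i) ≈ X u (R i) ⊝ sh 1ℤ (X u (R i)) ⊝ X u W
    X-E i = ≈-trans (X-⊝ u (R i ⊝ sh 1ℤ (R i)) W) (⊝-cong (X-⊝ u (R i) (sh 1ℤ (R i))) (≈-refl {F = X u W}))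

    X-sh-E : ∀ i → X u (sh (+ l) (E i)) ≈ X u (sh (+ l) (R i)) ⊝ sh 1ℤ (X u (sh (+ l) (R i))) ⊝ X u (sh (+ l) W)
    X-sh-E i = ≈-trans (X-⊝ u (sh (+ l) (R i ⊝ sh 1ℤ (R i))) (sh (+ l) W))
      (⊝-cong (≈-trans (X-⊝ u (sh (+ l) (R i)) (sh (+ l) (sh 1ℤ (R i))))
                       (⊝-cong (≈-refl {F = X u (sh (+ l) (R i))}) (X-cong u (sh-comm (+ l) 1ℤ (R i)))))
              (≈-refl {F = X u (sh (+ l) W)}))

    -- After multiplication by 1 - t the colored letters contribute t x_u W - t^l x_u W. With the
    -- term (1 - t) x_u W from u^0 this is x_u W - t^l x_u W, just what completes both sides to
    -- deviations.
    E-step : y l u (E (suc s)) ≈ y 0 u (E s)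
    E-step = pointwise λ k α →
      trans (cong (λ z → E (suc s) k α - z) (at (X-sh-E (suc s)) k α))
     (trans (algebra {r = R s k α} {R s (k - 1ℤ) α} {X u W k α} {xw₁ = X u W (k - 1ℤ) α} {xr = X u (R s) k α} {X u (R s) (k - 1ℤ) α}
                     {D l k α} {D l (k - 1ℤ) α} {b = X u (sh (+ l) (R (suc s))) k α} {X u (sh (+ l) (R (suc s))) (k - 1ℤ) α}
                     {W k α} {X u (sh (+ l) W) k α}
                     (R-recurrence k α) (R-recurrence (k - 1ℤ) α) (D-telescope l′ ℕP.≤-refl k α))
            (cong (λ z → E s k α - z) (sym (trans (at (sh-0 (E s)) k α) (at (X-E s) k α)))))
      where
      algebra : ∀ {r⁺ r⁺₁ r r₁ xw xw₁ xr xr₁ d d₁ b b₁ w xlw} →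
        r⁺ ≡ r + (xw - xr + (d + b)) → r⁺₁ ≡ r₁ + (xw₁ - xr₁ + (d₁ + b₁)) → d - d₁ ≡ xw₁ - xlw →
        r⁺ - r⁺₁ - w - (b - b₁ - xlw) ≡ r - r₁ - w - (xr - xr₁ - xw)
      algebra {r = r} {r₁} {xw} {xw₁} {xr} {xr₁} {d} {d₁} {b} {b₁} {w} {xlw} refl refl p =
        trans (lem₁ r r₁ xw xw₁ xr xr₁ d d₁ b b₁ w xlw) (trans (cong (λ z → r - r₁ + (xw - xw₁) - (xr - xr₁) + z - w + xlw) p) (lem₂ r r₁ xw xw₁ xr xr₁ w xlw))
        where
        lem₁ : ∀ r r₁ xw xw₁ xr xr₁ d d₁ b b₁ w xlw →
               r + (xw - xr + (d + b)) - (r₁ + (xw₁ - xr₁ + (d₁ + b₁))) - w - (b - b₁ - xlw) ≡ r - r₁ + (xw - xw₁) - (xr - xr₁) + (d - d₁) - w + xlw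
        lem₁ = solve-∀
        lem₂ : ∀ r r₁ xw xw₁ xr xr₁ w xlw → r - r₁ + (xw - xw₁) - (xr - xr₁) + (xw₁ - xlw) - w + xlw ≡ r - r₁ - w - (xr - xr₁ - xw)
        lem₂ = solve-∀

  E-cong : ∀ {F F′ : Series N} → F ≈ F′ → F ⊝ sh 1ℤ F ⊝ W ≈ F′ ⊝ sh 1ℤ F′ ⊝ W
  E-cong p = ⊝-cong (⊝-cong p (sh-cong 1ℤ p)) (≈-refl {F = W})

  transfer : B l id (W ⊝ sh 1ℤ W ⊝ W) ≈ B 0 id (δ ⊝ sh 1ℤ δ ⊝ W)
  transfer = ≈-trans (B-cong l id (E-cong (≈-sym R-N)))
    (≈-trans (B-chain l 0 id (λ i → R i ⊝ sh 1ℤ (R i) ⊝ W) Step.E-step) (B-cong 0 id (E-cong R-0)))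

-- Adjoining one-letter factors: Q = H G and W = H′ G.

module Euler (l′ N : ℕ) where

  open import Data.Integer using (ℤ; +_; -[1+_]; -_; _+_; _-_; 0ℤ; 1ℤ; -1ℤ)

  open Transfer l′ N public

  ∈? : ∀ (r : List Lt) R → Dec (r ∈ R)
  ∈? r R = any? (λ v → LP.≡-dec _≟L_ r v) R

  SingleBar : List Lt → Set
  SingleBar w = ∃[ u ] w ≡ bar u ∷ []

  singleZero? : Decidable SingleZero
  singleZero? w = FP.any? (λ u → LP.≡-dec _≟L_ w (unb u zero ∷ []))

  singleBar? : Decidable SingleBar
  singleBar? w = FP.any? (λ u → LP.≡-dec _≟L_ w (bar u ∷ []))

  Core : List Lt → Set
  Core w = CycOK w × ¬ SingleZero w × ¬ SingleBar w

  core? : Decidable Core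
  core? w = T? (cycOK w) ×-dec ¬? (singleZero? w) ×-dec ¬? (singleBar? w)

  Factors : (List Lt → Set) → List Lt → Set
  Factors P w = All P (factor w)

  factors? : ∀ {P : List Lt → Set} → Decidable P → Decidable (Factors P)
  factors? P? w = All.all? P? (factor w)

  G : Series N
  G = gf (factors? core?)

  -- Applied with `c u` = u^0, d = 0 for `Q`, and with `c u` = bar u, d = l for `W`. The letters are
  -- adjoined in order of absolute value, each contributing one linear factor.
  module Adjoin (c : Fin N → Lt) (d : ℕ) (val-c : ∀ u → val (c u) ≡ u) (stat-c : ∀ u → letterStat (c u) ≡ d)
                (not-core : ∀ u → ¬ Core (c u ∷ [])) where

    Allowed : ℕ → List Lt → Set
    Allowed s w = Core w ⊎ (∃[ u ] w ≡ c u ∷ [] × toℕ u ℕ.< s)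

    allowed? : ∀ s → Decidable (Allowed s)
    allowed? s w = core? w ⊎-dec FP.any? (λ u → LP.≡-dec _≟L_ w (c u ∷ []) ×-dec (toℕ u ℕP.<? s))

    M : ℕ → Series N
    M s = gf (factors? (allowed? s))

    M-0 : M 0 ≈ G
    M-0 = gf-cong (factors? (allowed? 0)) (factors? core?) (All.map (λ { (inj₁ p) → p ; (inj₂ (_ , _ , ())) })) (All.map inj₁)

    module _ (u : Fin N) where

      private
        s : ℕ
        s = toℕ u

        cu : List Lt
        cu = c u ∷ []

      Contains : List Lt → Set
      Contains w = Factors (Allowed (suc s)) w × cu ∈ factor w

      contains? : Decidable Contains
      contains? w = factors? (allowed? (suc s)) w ×-dec ∈? cu (factor w)

      cu-allowed : Allowed (suc s) cu
      cu-allowed = inj₂ (u , refl , ℕP.≤-refl)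

      insert-cu remove-cu : List Lt → List Lt
      insert-cu w = flat (insert cu (factor w))
      remove-cu w = flat (remove cu (factor w))

      factor-insert : ∀ w → factor (insert-cu w) ≡ insert cu (factor w)
      factor-insert w = factor-flat (insert-factorization (factor w) (singleton-Lyndon (c u)) (factor-factorization w))

      factor-remove : ∀ w → factor (remove-cu w) ≡ remove cu (factor w)
      factor-remove w = factor-flat (remove-factorization (factor w) (factor-factorization w))

      insert-cu-↭ : ∀ w → insert-cu w ↭ c u ∷ w
      insert-cu-↭ w = subst (λ v → insert-cu w ↭ c u ∷ v) (flat-factor w) (flat-insert-↭ cu (factor w))

      -- Only one copy of `c u` is removed and others may remain, hence `M (suc s)` on the right:
      -- repetition of the factor gives the full geometric series.
      gf-contains : gf contains? ≈ X u (sh (+ d) (M (suc s)))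
      gf-contains = gf-shift (factors? (allowed? (suc s))) contains? d u insert-cu remove-cu
        (λ {w} ps → (subst (All (Allowed (suc s))) (sym (factor-insert w)) (insert-All (factor w) cu-allowed ps) ,
                     subst (cu ∈_) (sym (factor-insert w)) (insert-∈ cu (factor w))) ,
                    trans (stat-↭ (insert-cu-↭ w)) (cong (ℕ._+ stat w) (stat-c u)) ,
                    trans (cont-↭ (insert-cu-↭ w)) (trans (cont-∷ (c u) w) (cong (λ v → inc v (cont w)) (val-c u))) ,
                    trans (cong (flat ∘ remove cu) (factor-insert w)) (trans (cong flat (remove-insert cu (factor w))) (flat-factor w)))
        (λ {w} (ps , cu∈) → subst (All (Allowed (suc s))) (sym (factor-remove w)) (remove-All (factor w) ps) ,
                    trans (cong (flat ∘ insert cu) (factor-remove w))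
                          (trans (cong flat (insert-remove (factor w) (sorted (factor-factorization w)) cu∈)) (flat-factor w)))

      M-suc : ∀ k α → M (suc s) k α ≡ M s k α + gf contains? k α
      M-suc = gf-⊎ (factors? (allowed? s)) contains? (factors? (allowed? (suc s))) (λ {w} → split {w})
        (All.map grow) proj₁ (λ {w} ps (_ , cu∈) → excluded (All.lookup ps cu∈))
        where
        shrink : ∀ {r} → cu ≢ r → Allowed (suc s) r → Allowed s r
        shrink ne (inj₁ p) = inj₁ p
        shrink ne (inj₂ (v , refl , s≤s v≤s)) with ℕP.m≤n⇒m<n∨m≡n v≤s
        ... | inj₁ v<s = inj₂ (v , refl , v<s)
        ... | inj₂ v≡s = ⊥-elim (ne (cong (λ v → c v ∷ []) (sym (FP.toℕ-injective v≡s))))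
        grow : ∀ {r} → Allowed s r → Allowed (suc s) r
        grow (inj₁ p)             = inj₁ p
        grow (inj₂ (v , eq , v<s)) = inj₂ (v , eq , ℕP.m<n⇒m<1+n v<s)
        split : ∀ {w} → Factors (Allowed (suc s)) w → Factors (Allowed s) w ⊎ Contains w
        split {w} ps with ∈? cu (factor w)
        ... | yes cu∈ = inj₂ (ps , cu∈)
        ... | no cu∉  = inj₁ (All.tabulate λ {r} r∈ → shrink (λ { refl → cu∉ r∈ }) (All.lookup ps r∈))
        excluded : ¬ Allowed s cu
        excluded (inj₁ p) = not-core u p
        excluded (inj₂ (v , eq , v<s)) = ℕP.<-irrefl (cong toℕ (trans (sym (val-c v)) (trans (cong val (sym (LP.∷-injectiveˡ eq))) (val-c u)))) v<s

      M-step : y d u (M (suc s)) ≈ M s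
      M-step = pointwise λ k α → lemma (M (suc s) k α) (M s k α) (gf contains? k α) (X u (sh (+ d) (M (suc s))) k α)
          (M-suc k α) (at gf-contains k α)
        where
        lemma : ∀ m⁺ m g x → m⁺ ≡ m + g → g ≡ x → m⁺ - x ≡ m
        lemma _ m g _ refl refl = lem m g
          where
          lem : ∀ m g → m + g - g ≡ m
          lem = solve-∀

    M-N : B d id (M N) ≈ G
    M-N = ≈-trans (B-telescope d id M M-step) M-0

  Neck : List Lt → Set
  Neck w = CycOK w × ¬ SingleBar w

  neck? : Decidable Neck
  neck? w = T? (cycOK w) ×-dec ¬? (singleBar? w)

  Q : Series N
  Q = gf (factors? neck?)

  Q-G : B 0 id Q ≈ G
  Q-G = ≈-trans (B-cong 0 id (gf-cong (factors? neck?) (factors? (allowed? N)) (All.map to) (All.map from))) M-N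
    where
    open Adjoin (λ u → unb u zero) 0 (λ _ → refl) (λ _ → refl) (λ u p → proj₁ (proj₂ p) (u , refl))
    to : ∀ {r} → Neck r → Allowed N r
    to {r} (ok , nb) with singleZero? r
    ... | yes (u , eq) = inj₂ (u , eq , FP.toℕ<n u)
    ... | no nz        = inj₁ (ok , nz , nb)
    from : ∀ {r} → Allowed N r → Neck r
    from (inj₁ (ok , _ , nb))  = ok , nb
    from (inj₂ (u , refl , _)) = Equivalence.from BP.T-∧ (okPair-refl (unb u zero) , tt) , λ { (_ , ()) }

  -- A word is good exactly when all its factors are, and the good Lyndon words are those of `Core`
  -- together with the single barred letters.
  W-G : B l id W ≈ G
  W-G = ≈-trans (B-cong l id (gf-cong good? (factors? (allowed? N)) (λ {w} → to {w}) (λ {w} → from {w}))) M-N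
    where
    open Adjoin bar l (λ _ → refl) (λ _ → refl) (λ u p → proj₂ (proj₂ p) (u , refl))
    to-factor : ∀ {r} → Lyndon r × Good r → Allowed N r
    to-factor {r} (ly , g) with Good⇒CycOK ly g | singleBar? r
    ... | _       | yes (u , eq) = inj₂ (u , eq , FP.toℕ<n u)
    ... | ok , nz | no nb        = inj₁ (ok , nz , nb)
    from-factor : ∀ {r} → Lyndon r × Allowed N r → Good r
    from-factor (ly , inj₁ (ok , nz , _))   = CycOK⇒Good ly ok nz
    from-factor (ly , inj₂ (u , refl , _)) = λ { (_ , ()) }
    to : ∀ {w} → Good w → Factors (Allowed N) w
    to {w} g = All.map to-factor (All.zip (lyndon f , flat-Good⁻ f (subst Good (sym (flat-factor w)) g)))
      where f = factor-factorization w
    from : ∀ {w} → Factors (Allowed N) w → Good w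
    from {w} ps = subst Good (flat-factor w) (flat-Good f (All.map from-factor (All.zip (lyndon f , ps))))
      where f = factor-factorization w

  cont-empty : ∀ {α} → cont [] ≡ α → V.sum α ≡ 0
  cont-empty refl = sum-cont []

  flip-δ : flip l δ ≈ δ
  flip-δ = pointwise λ k α → via-hits empty? empty? (k̄ k α) k α (bijection-length id id (hits-Unique empty? {k̄ k α} {α}) (hits-Unique empty? {k} {α})
    (λ w∈ → ∈-hits⁺ empty? (there′ k α (∈-hits⁻ empty? {k̄ k α} {α} w∈)) , refl)
    (λ w∈ → ∈-hits⁺ empty? (back k α (∈-hits⁻ empty? {k} {α} w∈)) , refl))
    where
    k̄ : ℤ → Vec ℕ N → ℤ
    k̄ k α = + (l ℕ.* V.sum α) - k
    k̄≡ : ∀ k α → V.sum α ≡ 0 → k̄ k α ≡ - k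
    k̄≡ k α eq = trans (cong (λ m → + m - k) (trans (cong (l ℕ.*_) eq) (ℕP.*-zeroʳ l))) (ℤP.+-identityˡ (- k))
    there′ : ∀ k α {w} → Hit Empty (k̄ k α) α w → Hit Empty k α w
    there′ k α (refl , s , ct) = refl , ℤP.neg-injective (trans s (k̄≡ k α (cont-empty ct))) , ct
    back : ∀ k α {w} → Hit Empty k α w → Hit Empty (k̄ k α) α w
    back k α (refl , s , ct) = refl , trans (cong -_ s) (sym (k̄≡ k α (cont-empty ct))) , ct

  open Symmetry l δ Q W G flip-δ Q-G W-G transfer public using (H; S; S-difference)

-- Ornaments as Lyndon factorizations.

T-not⁺ : ∀ {b} → ¬ T b → T (not b)
T-not⁺ {false} _ = tt
T-not⁺ {true}  h = h tt

T-not⁻ : ∀ {b} → T (not b) → ¬ T b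
T-not⁻ {false} _ ()

module Ornaments (l′ N : ℕ) where

  open import Data.Integer using (ℤ; +_; -[1+_]; -_; _+_; _-_; 0ℤ; 1ℤ; -1ℤ)

  open Euler l′ N public

  lexLeq⇒≼ : ∀ (u v : List Lt) → T (lexLeq u v) → u ≼ v
  lexLeq⇒≼ (x ∷ u) (y ∷ v) h q with Equivalence.to (BP.T-∨ {key x ℕ.<ᵇ key y}) h
  lexLeq⇒≼ (x ∷ u) (y ∷ v) h (this y<x) | inj₁ x<y = ℕP.<-asym y<x (ℕP.<ᵇ⇒< (key x) (key y) x<y)
  lexLeq⇒≼ (x ∷ u) (.x ∷ v) h (next q)  | inj₁ x<x = ℕP.<-irrefl refl (ℕP.<ᵇ⇒< (key x) (key x) x<x)
  lexLeq⇒≼ (x ∷ u) (y ∷ v) h (this y<x) | inj₂ h′ =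
    ℕP.<-irrefl (sym (ℕP.≡ᵇ⇒≡ (key x) (key y) (proj₁ (Equivalence.to (BP.T-∧ {key x ≡ᵇ key y}) h′)))) y<x
  lexLeq⇒≼ (x ∷ u) (.x ∷ v) h (next q)  | inj₂ h′ =
    lexLeq⇒≼ u v (proj₂ (Equivalence.to (BP.T-∧ {key x ≡ᵇ key x}) h′)) q

  ≼⇒lexLeq : ∀ (u v : List Lt) → u ≼ v → T (lexLeq u v)
  ≼⇒lexLeq []      v       p = tt
  ≼⇒lexLeq (x ∷ u) []      p = ⊥-elim (p end)
  ≼⇒lexLeq (x ∷ u) (y ∷ v) p with ℕP.<-cmp (key x) (key y)
  ... | tri< x<y _ _ = Equivalence.from (BP.T-∨ {key x ℕ.<ᵇ key y}) (inj₁ (ℕP.<⇒<ᵇ x<y))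
  ... | tri> _ _ y<x = ⊥-elim (p (this y<x))
  ... | tri≈ _ x≡y _ with key-injective {x} {y} x≡y
  ... | refl = Equivalence.from (BP.T-∨ {key x ℕ.<ᵇ key x}) (inj₂ (Equivalence.from (BP.T-∧ {key x ≡ᵇ key x}) (ℕP.≡⇒≡ᵇ (key x) (key x) refl , ≼⇒lexLeq u v (p ∘ next))))

  rotate-++ : ∀ (u v : List Lt) → rotate (length u) (u ++ v) ≡ v ++ u
  rotate-++ []      v = sym (LP.++-identityʳ v)
  rotate-++ (x ∷ u) v = trans (cong (rotate (length u)) (LP.++-assoc u v (x ∷ [])))
    (trans (rotate-++ u (v ++ x ∷ [])) (LP.++-assoc v (x ∷ []) u))

  isCanonical⇒LeastRotation : ∀ w → T (isCanonical w) → LeastRotation w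
  isCanonical⇒LeastRotation w h u {v} refl v≢[] =
    subst (u ++ v ≼_) (rotate-++ u v) (lexLeq⇒≼ _ _ (All.lookup (AllP.all⁺ _ (upTo (length w)) h) (∈-upTo⁺ shorter)))
    where
    nonempty-length : ∀ {v : List Lt} → v ≢ [] → 0 ℕ.< length v
    nonempty-length {[]}    ne = ⊥-elim (ne refl)
    nonempty-length {_ ∷ _} ne = s≤s z≤n
    shorter : length u ℕ.< length (u ++ v)
    shorter = ℕP.≤-trans (ℕP.m<m+n (length u) (nonempty-length v≢[])) (ℕP.≤-reflexive (sym (LP.length-++ u)))

  LeastRotation⇒isCanonical : ∀ w → LeastRotation w → T (isCanonical w)
  LeastRotation⇒isCanonical w h = AllP.all⁻ _ (All.tabulate λ {d} d∈ → rotation d (∈-upTo⁻ d∈))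
    where
    rotation : ∀ d → d ℕ.< length w → T (lexLeq w (rotate d w))
    rotation d d<n = ≼⇒lexLeq w _ (subst (w ≼_) (sym rotated) (h (take d w) (sym (LP.take++drop≡id d w)) drop≢[]))
      where
      rotated : rotate d w ≡ drop d w ++ take d w
      rotated = trans (cong₂ rotate (sym (trans (LP.length-take d w) (ℕP.m≤n⇒m⊓n≡m (ℕP.<⇒≤ d<n)))) (sym (LP.take++drop≡id d w)))
                      (rotate-++ (take d w) (drop d w))
      drop≢[] : drop d w ≢ []
      drop≢[] eq = ℕP.<⇒≢ (ℕP.m<n⇒0<n∸m d<n) (sym (trans (sym (LP.length-drop d w)) (cong length eq)))

  take-++-length : ∀ (z : List Lt) {v} → take (length z) (z ++ v) ≡ z
  take-++-length []      = refl
  take-++-length (x ∷ z) = cong (x ∷_) (take-++-length z)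

  length-^ : ∀ (z : List Lt) k → length (z ^ k) ≡ k ℕ.* length z
  length-^ z zero    = refl
  length-^ z (suc k) = trans (LP.length-++ z) (cong (length z ℕ.+_) (length-^ z k))

  isPrimitive⇒Primitive : ∀ {w} → w ≢ [] → T (isPrimitive w) → Primitive w
  isPrimitive⇒Primitive {w} w≢[] h z k w≡ = T-not⁻ h (AnyP.any⁺ _ (lose (∈-upTo⁺ k<n) test))
    where
    len : length w ≡ length z ℕ.* suc (suc k)
    len = trans (cong length w≡) (trans (length-^ z (suc (suc k))) (ℕP.*-comm (suc (suc k)) (length z)))
    z≢0 : length z ≢ 0
    z≢0 eq = w≢[] (length-0 (trans len (cong (ℕ._* suc (suc k)) eq)))
      where
      length-0 : ∀ {v : List Lt} → length v ≡ 0 → v ≡ []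
      length-0 {[]} _ = refl
    -- The index k tests the exponent k + 2. A nonempty root gives k + 2 at most the length of `w`,
    -- so k lies in the tested range.
    k<n : k ℕ.< length w
    k<n = ℕP.≤-trans (ℕP.n≤1+n (suc k)) (ℕP.≤-trans (ℕP.m≤n*m (suc (suc k)) (length z) {{ℕ.≢-nonZero z≢0}}) (ℕP.≤-reflexive (sym len)))
    root : take (length w ℕ./ suc (suc k)) w ≡ z
    root = trans (cong₂ take (trans (cong (ℕ._/ suc (suc k)) len) (DM.m*n/n≡m (length z) (suc (suc k)))) w≡) (take-++-length z)
    test = Equivalence.from BP.T-∧
      ( fromWitness {a? = suc (suc k) ∣? length w} (divides (length z) len)
      , fromWitness {a? = LP.≡-dec _≟L_ (take (length w ℕ./ suc (suc k)) w ^ suc (suc k)) w} (trans (cong (_^ suc (suc k)) root) (sym w≡)))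

  Primitive⇒isPrimitive : ∀ w → Primitive w → T (isPrimitive w)
  Primitive⇒isPrimitive w prim = T-not⁺ λ h → let j , _ , t = find (AnyP.any⁻ _ (upTo (length w)) h) in
    prim (take (length w ℕ./ suc (suc j)) w) j (sym (toWitness (proj₂ (Equivalence.to (BP.T-∧ {⌊ suc (suc j) ∣? length w ⌋}) t))))

  notSingleBar⇒¬SingleBar : ∀ w → T (notSingleBar w) → ¬ SingleBar w
  notSingleBar⇒¬SingleBar _ h (_ , refl) = h

  ¬SingleBar⇒notSingleBar : ∀ w → ¬ SingleBar w → T (notSingleBar w)
  ¬SingleBar⇒notSingleBar []              h = tt
  ¬SingleBar⇒notSingleBar (unb u m ∷ [])  h = tt
  ¬SingleBar⇒notSingleBar (bar u ∷ [])    h = h (u , refl)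
  ¬SingleBar⇒notSingleBar (unb _ _ ∷ _ ∷ _) h = tt
  ¬SingleBar⇒notSingleBar (bar _ ∷ _ ∷ _) h = tt

  IsNeck : List Lt → Set
  IsNeck w = Lyndon w × Neck w

  necklaceTest : List Lt → Bool
  necklaceTest w = isNecklace w ∧ isCanonical w

  necklaceTest⇒IsNeck : ∀ {w} → w ≢ [] → T (necklaceTest w) → IsNeck w
  necklaceTest⇒IsNeck {w} w≢[] h with Equivalence.to (BP.T-∧ {isNecklace w}) h
  ... | nk , can with Equivalence.to (BP.T-∧ {isPrimitive w}) nk
  ... | prim , rest with Equivalence.to (BP.T-∧ {cycOK w}) rest
  ... | ok , nb = Primitive∧LeastRotation⇒Lyndon w≢[] (isPrimitive⇒Primitive w≢[] prim) (isCanonical⇒LeastRotation w can) ,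
                  ok , notSingleBar⇒¬SingleBar w nb

  IsNeck⇒necklaceTest : ∀ {w} → IsNeck w → T (necklaceTest w)
  IsNeck⇒necklaceTest {w} (ly , ok , nb) = Equivalence.from (BP.T-∧ {isNecklace w})
    ( Equivalence.from (BP.T-∧ {isPrimitive w}) (Primitive⇒isPrimitive w (Lyndon⇒Primitive ly) ,
        Equivalence.from (BP.T-∧ {cycOK w}) (ok , ¬SingleBar⇒notSingleBar w nb))
    , LeastRotation⇒isCanonical w (Lyndon⇒LeastRotation ly))

  necklaces-Unique : ∀ s → Unique (necklaces l N s)
  necklaces-Unique s = UP.filter⁺ (T? ∘ necklaceTest) (words-Unique s)

  ∈-necklaces⁺ : ∀ {w} → IsNeck w → w ∈ necklaces l N (length w)
  ∈-necklaces⁺ {w} n = ∈-filter⁺ (T? ∘ necklaceTest) (∈-words w) (IsNeck⇒necklaceTest n)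

  -- Lengths start at one because the empty word passes the Boolean test without being Lyndon.
  ∈-necklaces⁻ : ∀ {s w} → w ∈ necklaces l N (suc s) → IsNeck w × length w ≡ suc s
  ∈-necklaces⁻ {s} {w} w∈ with ∈-filter⁻ (T? ∘ necklaceTest) {xs = allWords l N (suc s)} w∈
  ... | a , b = necklaceTest⇒IsNeck nonempty b , words-length (suc s) a
    where
    nonempty : w ≢ []
    nonempty refl with words-length (suc s) a
    ... | ()

  private
    withHead : ℕ → ℕ → List Lt → List (List (List Lt))
    withHead f n r = L.map (r ∷_) (necklaceLists l N f n)

    withHeadLength : ℕ → ℕ → ℕ → List (List (List Lt))
    withHeadLength f r s = concatMap (withHead f (suc r ∸ s)) (necklaces l N s)

  ∈-withHeadLength⁻ : ∀ {f r s R} → R ∈ withHeadLength f r s →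
                      ∃[ w ] ∃[ R′ ] w ∈ necklaces l N s × R′ ∈ necklaceLists l N f (suc r ∸ s) × R ≡ w ∷ R′
  ∈-withHeadLength⁻ {f} {r} {s} R∈ with find (∈-concatMap⁻ (withHead f (suc r ∸ s)) {xs = necklaces l N s} R∈)
  ... | w , w∈ , R∈′ with ∈-map⁻ (w ∷_) R∈′
  ... | R′ , R′∈ , eq = w , R′ , w∈ , R′∈ , eq

  necklaceLists-Unique : ∀ f r → Unique (necklaceLists l N f r)
  necklaceLists-Unique zero    zero    = [] ∷ []
  necklaceLists-Unique (suc f) zero    = [] ∷ []
  necklaceLists-Unique zero    (suc r) = []
  necklaceLists-Unique (suc f) (suc r) = concatMap-Unique (UP.map⁺ ℕP.suc-injective (UP.upTo⁺ (suc r)))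
    (λ s → concatMap-Unique (necklaces-Unique s) (λ w → UP.map⁺ LP.∷-injectiveʳ (necklaceLists-Unique f (suc r ∸ s))) (same-head {suc r ∸ s}))
    same-length
    where
    same-head : ∀ {n w w′ R} → R ∈ withHead f n w → R ∈ withHead f n w′ → w ≡ w′
    same-head {w = w} {w′} a b with ∈-map⁻ (w ∷_) a | ∈-map⁻ (w′ ∷_) b
    ... | _ , _ , refl | _ , _ , refl = refl
    same-length : ∀ {s s′ R} → R ∈ withHeadLength f r s → R ∈ withHeadLength f r s′ → s ≡ s′
    same-length {s} {s′} a b with ∈-withHeadLength⁻ {f} {r} {s} a | ∈-withHeadLength⁻ {f} {r} {s′} b
    ... | w , _ , w∈ , _ , refl | _ , _ , w∈′ , _ , refl = trans (sym (len s w∈)) (len s′ w∈′)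
      where
      len : ∀ s → w ∈ necklaces l N s → length w ≡ s
      len s w∈ = words-length s (proj₁ (∈-filter⁻ (T? ∘ necklaceTest) {xs = allWords l N s} w∈))

  ∈-necklaceLists⁻ : ∀ f r {R} → R ∈ necklaceLists l N f r → All IsNeck R × length (concat R) ≡ r
  ∈-necklaceLists⁻ zero    zero    (here refl) = [] , refl
  ∈-necklaceLists⁻ (suc f) zero    (here refl) = [] , refl
  ∈-necklaceLists⁻ (suc f) (suc r) R∈ with find (∈-concatMap⁻ (withHeadLength f r) {xs = L.map suc (upTo (suc r))} R∈)
  ... | s , s∈ , R∈′ with ∈-map⁻ suc s∈ | ∈-withHeadLength⁻ {f} {r} {s} R∈′
  ... | i , i∈ , refl | w , R′ , w∈ , R′∈ , refl with ∈-necklaces⁻ w∈ | ∈-necklaceLists⁻ f (r ∸ i) R′∈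
  ... | n , len | ns , lens = n ∷ ns , trans (LP.length-++ w) (trans (cong₂ ℕ._+_ len lens) (cong suc (ℕP.m+[n∸m]≡n (ℕP.≤-pred (∈-upTo⁻ i∈)))))

  -- Every necklace uses up at least one letter, so fuel equal to the total length suffices.
  ∈-necklaceLists⁺ : ∀ f r {R} → r ℕ.≤ f → All IsNeck R → length (concat R) ≡ r → R ∈ necklaceLists l N f r
  ∈-necklaceLists⁺ zero    zero    {[]} _ _ _ = here refl
  ∈-necklaceLists⁺ (suc f) zero    {[]} _ _ _ = here refl
  ∈-necklaceLists⁺ f       r       {[] ∷ R} _ (((ne , _) , _) ∷ _) _ = ⊥-elim (ne refl)
  ∈-necklaceLists⁺ (suc f) (suc r) {w@(x ∷ v) ∷ R} (s≤s r≤f) (n ∷ ns) eq =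
    ∈-concatMap⁺ (withHeadLength f r) (lose (∈-map⁺ suc (∈-upTo⁺ (s≤s v≤r)))
      (∈-concatMap⁺ (withHead f (r ∸ length v)) (lose (∈-necklaces⁺ n)
        (∈-map⁺ (w ∷_) (∈-necklaceLists⁺ f (r ∸ length v) (ℕP.≤-trans (ℕP.m∸n≤m r (length v)) r≤f) ns rest)))))
    where
    total : length v ℕ.+ length (concat R) ≡ r
    total = trans (sym (LP.length-++ v)) (ℕP.suc-injective eq)
    v≤r : length v ℕ.≤ r
    v≤r = ℕP.≤-trans (ℕP.m≤m+n (length v) _) (ℕP.≤-reflexive total)
    rest : length (concat R) ≡ r ∸ length v
    rest = trans (sym (ℕP.m+n∸m≡n (length v) _)) (cong (_∸ length v) total)

  sortedB⇒Linked : ∀ R → T (sortedB R) → Linked _≼_ R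
  sortedB⇒Linked []          h = []
  sortedB⇒Linked (x ∷ [])    h = [-]
  sortedB⇒Linked (x ∷ y ∷ R) h =
    let a , b = Equivalence.to (BP.T-∧ {lexLeq x y}) h in lexLeq⇒≼ x y a ∷ sortedB⇒Linked (y ∷ R) b

  Linked⇒sortedB : ∀ {R} → Linked _≼_ R → T (sortedB R)
  Linked⇒sortedB []      = tt
  Linked⇒sortedB [-]     = tt
  Linked⇒sortedB (_∷_ {x} {y} a b) = Equivalence.from (BP.T-∧ {lexLeq x y}) (≼⇒lexLeq x y a , Linked⇒sortedB b)

  ornaments-Unique : ∀ n → Unique (ornaments l N n)
  ornaments-Unique n = UP.filter⁺ (T? ∘ sortedB) (necklaceLists-Unique n n)

  ∈-ornaments⁻ : ∀ n {R} → R ∈ ornaments l N n → Factorization R × All Neck R × length (concat R) ≡ n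
  ∈-ornaments⁻ n {R} R∈ with ∈-filter⁻ (T? ∘ sortedB) {xs = necklaceLists l N n n} R∈
  ... | a , b with ∈-necklaceLists⁻ n n a
  ... | ns , len = factorization (Linked⇒AllPairs ≼-trans (sortedB⇒Linked R b)) (All.map proj₁ ns) , All.map proj₂ ns , len

  ∈-ornaments⁺ : ∀ n {R} → Factorization R → All Neck R → length (concat R) ≡ n → R ∈ ornaments l N n
  ∈-ornaments⁺ n (factorization s ly) ns len = ∈-filter⁺ (T? ∘ sortedB)
    (∈-necklaceLists⁺ n n ℕP.≤-refl (All.zip (ly , ns)) len) (Linked⇒sortedB (AllPairs⇒Linked s))

  weightTest : ℕ → Vec ℕ N → List (List Lt) → Bool
  weightTest k α R = (ornStat R ≡ᵇ k) ∧ vecEq (content R) α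

  -- Nondecreasing lists of canonical representatives are Lyndon factorizations written last factor
  -- first, so `flat` and `factor` are mutually inverse here. Statistic and content depend only on
  -- the letters up to permutation.
  ornaments-Q : ∀ m k α → V.sum α ≡ m → + length (filterᵇ (weightTest k α) (ornaments l N m)) ≡ Q (+ k) α
  ornaments-Q m k α refl = trans (cong +_ (bijection-length flat factor
      (UP.filter⁺ (T? ∘ weightTest k α) (ornaments-Unique m)) (hits-Unique (factors? neck?) {+ k} {α}) to from))
      (sym (gf-hits (factors? neck?) (+ k) α))
    where
    to : ∀ {R} → R ∈ filterᵇ (weightTest k α) (ornaments l N m) → flat R ∈ hits (factors? neck?) (+ k) α × factor (flat R) ≡ R
    to {R} R∈ with ∈-filter⁻ (T? ∘ weightTest k α) {xs = ornaments l N m} R∈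
    ... | a , b with ∈-ornaments⁻ m a | Equivalence.to (BP.T-∧ {ornStat R ≡ᵇ k}) b
    ... | f , ns , len | st , ct = ∈-hits⁺ (factors? neck?)
      ( subst (All Neck) (sym (factor-flat f)) ns
      , cong +_ (trans (stat-↭ (flat-↭-concat R)) (ℕP.≡ᵇ⇒≡ (ornStat R) k st))
      , trans (cont-↭ (flat-↭-concat R)) (toWitness ct)) , factor-flat f
    from : ∀ {w} → w ∈ hits (factors? neck?) (+ k) α → factor w ∈ filterᵇ (weightTest k α) (ornaments l N m) × flat (factor w) ≡ w
    from {w} w∈ with ∈-hits⁻ (factors? neck?) {+ k} {α} w∈
    ... | ns , st , ct = ∈-filter⁺ (T? ∘ weightTest k α)
        (∈-ornaments⁺ m (factor-factorization w) ns
          (trans (sym (↭-length perm)) (trans (sym (sum-cont w)) (cong V.sum ct))))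
        (Equivalence.from (BP.T-∧ {ornStat (factor w) ≡ᵇ k})
          ( ℕP.≡⇒≡ᵇ (ornStat (factor w)) k (trans (sym (stat-↭ perm)) (ℤP.+-injective st))
          , fromWitness (trans (sym (cont-↭ perm)) ct))) , flat-factor w
      where
      perm : w ↭ concat (factor w)
      perm = subst (_↭ concat (factor w)) (flat-factor w) (flat-↭-concat (factor w))

  ornaments-0 : ∀ m k α → V.sum α ≢ m → length (filterᵇ (weightTest k α) (ornaments l N m)) ≡ 0
  ornaments-0 m k α ne = cong length (LP.filter-none (T? ∘ weightTest k α) (All.tabulate λ {R} R∈ h →
    ne (trans (cong V.sum (sym (toWitness (proj₂ (Equivalence.to (BP.T-∧ {ornStat R ≡ᵇ k}) h)))))
              (trans (sum-cont (concat R)) (proj₂ (proj₂ (∈-ornaments⁻ m R∈)))))))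

-- Coefficients of the two sides.

ΣL : ∀ {A : Set} → List A → (A → ℕ) → ℕ
ΣL xs f = sum (L.map f xs)

module _ {A : Set} where

  open import Data.Integer using (+_; _+_)

  ΣL-cong : ∀ {f g : A → ℕ} xs → (∀ {x} → x ∈ xs → f x ≡ g x) → ΣL xs f ≡ ΣL xs g
  ΣL-cong []       p = refl
  ΣL-cong (x ∷ xs) p = cong₂ ℕ._+_ (p (here refl)) (ΣL-cong xs (p ∘ there))

  ΣL-+ : ∀ (f g : A → ℕ) xs → ΣL xs (λ x → f x ℕ.+ g x) ≡ ΣL xs f ℕ.+ ΣL xs g
  ΣL-+ f g []       = refl
  ΣL-+ f g (x ∷ xs) = trans (cong (f x ℕ.+ g x ℕ.+_) (ΣL-+ f g xs)) (lemma (f x) (g x) (ΣL xs f) (ΣL xs g))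
    where
    lemma : ∀ a b c d → a ℕ.+ b ℕ.+ (c ℕ.+ d) ≡ a ℕ.+ c ℕ.+ (b ℕ.+ d)
    lemma = ℕSolver.solve-∀

  ΣL-0 : ∀ {f : A → ℕ} xs → (∀ {x} → x ∈ xs → f x ≡ 0) → ΣL xs f ≡ 0
  ΣL-0 []       p = refl
  ΣL-0 (x ∷ xs) p = cong₂ ℕ._+_ (p (here refl)) (ΣL-0 xs (p ∘ there))

  ΣL-ℤ : ∀ {f : A → ℕ} {h : A → ℤ} xs → (∀ {x} → x ∈ xs → + f x ≡ h x) → + ΣL xs f ≡ sumℤ (L.map h xs)
  ΣL-ℤ []       p = refl
  ΣL-ℤ {f} (x ∷ xs) p = trans (ℤP.pos-+ (f x) (ΣL xs f)) (cong₂ _+_ (p (here refl)) (ΣL-ℤ xs (p ∘ there)))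

  length-filterᵇ : ∀ (p : A → Bool) xs → length (filterᵇ p xs) ≡ ΣL xs (λ x → if p x then 1 else 0)
  length-filterᵇ p []       = refl
  length-filterᵇ p (x ∷ xs) with p x
  ... | true  = cong suc (length-filterᵇ p xs)
  ... | false = length-filterᵇ p xs

ΣL-swap : ∀ {A C : Set} (f : A → C → ℕ) xs ys → ΣL xs (λ x → ΣL ys (f x)) ≡ ΣL ys (λ y → ΣL xs (λ x → f x y))
ΣL-swap f []       ys = sym (ΣL-0 ys (λ _ → refl))
ΣL-swap f (x ∷ xs) ys = trans (cong (ΣL ys (f x) ℕ.+_) (ΣL-swap f xs ys)) (sym (ΣL-+ (f x) (λ y → ΣL xs (λ x → f x y)) ys))

≡ᵇ-≢ : ∀ {s i} → s ≢ i → (s ≡ᵇ i) ≡ false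
≡ᵇ-≢ {s} {i} ne with s ≡ᵇ i in eq
... | false = refl
... | true  = ⊥-elim (ne (ℕP.≡ᵇ⇒≡ s i (subst T (sym eq) tt)))

≡ᵇ-refl : ∀ s → (s ≡ᵇ s) ≡ true
≡ᵇ-refl zero    = refl
≡ᵇ-refl (suc s) = ≡ᵇ-refl s

ΣL-indicator : ∀ {s} (g : ℕ → ℕ) {is} → Unique is → s ∈ is → ΣL is (λ i → if s ≡ᵇ i then g i else 0) ≡ g s
ΣL-indicator {s} g (s∉ ∷ u) (here refl) rewrite ≡ᵇ-refl s =
  trans (cong (g s ℕ.+_) (ΣL-0 _ (λ {i} i∈ → cong (λ b → if b then g i else 0) (≡ᵇ-≢ (All.lookup s∉ i∈))))) (ℕP.+-identityʳ (g s))
ΣL-indicator {s} g {i ∷ is} (i∉ ∷ u) (there s∈) rewrite ≡ᵇ-≢ {s} {i} (λ { refl → All.lookup i∉ s∈ refl }) = ΣL-indicator g u s∈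

below-sum : ∀ {N} (α : Vec ℕ N) {β} → β ∈ below α → V.sum β ℕ.+ V.sum (zipWith _∸_ α β) ≡ V.sum α
below-sum []      (here refl) = refl
below-sum (a ∷ α) β∈ with find (∈-concatMap⁻ (λ c → L.map (c ∷_) (below α)) {xs = upTo (suc a)} β∈)
... | c , c∈ , β∈′ with ∈-map⁻ (c ∷_) β∈′
... | β , β∈″ , refl = trans (lemma c (V.sum β) (a ∸ c) (V.sum (zipWith _∸_ α β)))
    (cong₂ ℕ._+_ (ℕP.m+[n∸m]≡n (ℕP.≤-pred (∈-upTo⁻ c∈))) (below-sum α β∈″))
  where
  lemma : ∀ a b c d → a ℕ.+ b ℕ.+ (c ℕ.+ d) ≡ a ℕ.+ c ℕ.+ (b ℕ.+ d)
  lemma = ℕSolver.solve-∀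

module Sides (l′ N : ℕ) where

  open import Data.Integer using (ℤ; +_; -[1+_]; -_; _+_; _-_; 0ℤ; 1ℤ; -1ℤ)

  open Ornaments l′ N public

  -- This ensures that the sum over j up to m in `coefQ` meets every ornament, once.
  numSingle0≤length : ∀ m {R} → R ∈ ornaments l N m → numSingle0 R ℕ.≤ m
  numSingle0≤length m {R} R∈ with ∈-ornaments⁻ m R∈
  ... | f , _ , len = ℕP.≤-trans (LP.length-filter (T? ∘ single0) R) (ℕP.≤-trans (count R (lyndon f)) (ℕP.≤-reflexive len))
    where
    count : ∀ R → All Lyndon R → length R ℕ.≤ length (concat R)
    count []            _               = z≤n
    count ([] ∷ R)      ((ne , _) ∷ _)  = ⊥-elim (ne refl)
    count ((x ∷ w) ∷ R) (_ ∷ ls)        = s≤s (ℕP.≤-trans (count R ls) (suffix-length w))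

  coefQ-ornaments : ∀ m k α → coefQ l N m k α ≡ length (filterᵇ (weightTest k α) (ornaments l N m))
  coefQ-ornaments m k α =
    trans (ΣL-cong (upTo (suc m)) (λ {j} _ → length-filterᵇ (test j) (ornaments l N m)))
   (trans (ΣL-swap (λ j R → if test j R then 1 else 0) (upTo (suc m)) (ornaments l N m))
   (trans (ΣL-cong (ornaments l N m) per-ornament) (sym (length-filterᵇ (weightTest k α) (ornaments l N m)))))
    where
    test : ℕ → List (List Lt) → Bool
    test j R = (ornStat R ≡ᵇ k) ∧ (numSingle0 R ≡ᵇ j) ∧ vecEq (content R) α
    per-ornament : ∀ {R} → R ∈ ornaments l N m → ΣL (upTo (suc m)) (λ j → if test j R then 1 else 0) ≡ (if weightTest k α R then 1 else 0)
    per-ornament {R} R∈ with ornStat R ≡ᵇ k | vecEq (content R) α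
    ... | false | _     = ΣL-0 (upTo (suc m)) (λ _ → refl)
    ... | true  | false = ΣL-0 (upTo (suc m)) (λ {j} _ → cong (λ b → if b then 1 else 0) (BP.∧-zeroʳ (numSingle0 R ≡ᵇ j)))
    ... | true  | true  = trans (ΣL-cong (upTo (suc m)) (λ {j} _ → cong (λ b → if b then 1 else 0) (BP.∧-identityʳ (numSingle0 R ≡ᵇ j))))
                                (ΣL-indicator (λ _ → 1) (UP.upTo⁺ (suc m)) (∈-upTo⁺ (s≤s (numSingle0≤length m R∈))))

  Q-δ-0 : ∀ k γ → V.sum γ ≡ 0 → Q k γ ≡ δ k γ
  Q-δ-0 k γ eq = via-hits (factors? neck?) empty? k k γ (bijection-length id id
      (hits-Unique (factors? neck?) {k} {γ}) (hits-Unique empty? {k} {γ}) to from)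
    where
    length-0 : ∀ (w : List Lt) → length w ≡ 0 → w ≡ []
    length-0 [] _ = refl
    to : ∀ {w} → w ∈ hits (factors? neck?) k γ → w ∈ hits empty? k γ × w ≡ w
    to {w} w∈ with ∈-hits⁻ (factors? neck?) {k} {γ} w∈
    ... | _ , st , ct = ∈-hits⁺ empty? (length-0 w (trans (sym (sum-cont w)) (trans (cong V.sum ct) eq)) , st , ct) , refl
    from : ∀ {w} → w ∈ hits empty? k γ → w ∈ hits (factors? neck?) k γ × w ≡ w
    from {w} w∈ with ∈-hits⁻ empty? {k} {γ} w∈
    ... | refl , st , ct = ∈-hits⁺ (factors? neck?) ([] , st , ct) , refl

  δ-vanishes : ∀ k γ → (k ≡ 0ℤ → V.sum γ ≡ 0 → ⊥) → δ k γ ≡ 0ℤ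
  δ-vanishes k γ no-hit = trans (gf-hits empty? k γ) (cong +_ (none (hits empty? k γ) (λ w∈ → impossible (∈-hits⁻ empty? {k} {γ} w∈))))
    where
    none : ∀ (ws : List (List Lt)) → (∀ {w} → w ∈ ws → ⊥) → length ws ≡ 0
    none []      _ = refl
    none (w ∷ _) h = ⊥-elim (h (here refl))
    impossible : ∀ {w} → Hit Empty k γ w → ⊥
    impossible (refl , st , ct) = no-hit (sym st) (cont-empty ct)

  H-vanishes : ∀ k α → k ≢ 0ℤ → H k α ≡ 0ℤ
  H-vanishes k α k≢0 = zeros (below α)
    where
    zeros : ∀ βs → sumℤ (L.map (λ β → δ k (zipWith _∸_ α β)) βs) ≡ 0ℤ
    zeros []       = refl
    zeros (β ∷ βs) = cong₂ _+_ (δ-vanishes k (zipWith _∸_ α β) (λ eq _ → k≢0 eq)) (zeros βs)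

  term : ℕ → ℕ → Vec ℕ N → Vec ℕ N → ℕ → ℕ
  term n c α β i = coefH i β ℕ.* coefQ l N (n ∸ i) c (zipWith _∸_ α β)

  coefSide-swap : ∀ n c α → coefSide l N n c α ≡ ΣL (below α) (λ β → ΣL (upTo n) (term n c α β))
  coefSide-swap n c α = ΣL-swap (λ i β → term n c α β i) (upTo n) (below α)

  term-indicator : ∀ n c α β i → term n c α β i ≡ (if V.sum β ≡ᵇ i then coefQ l N (n ∸ i) c (zipWith _∸_ α β) else 0)
  term-indicator n c α β i with V.sum β ≡ᵇ i
  ... | true  = ℕP.+-identityʳ _
  ... | false = refl

  term-≢ : ∀ n c α β {i} → V.sum β ≢ i → term n c α β i ≡ 0
  term-≢ n c α β {i} ne = trans (term-indicator n c α β i)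
    (cong (λ b → if b then coefQ l N (n ∸ i) c (zipWith _∸_ α β) else 0) (≡ᵇ-≢ ne))

  coefSide-0 : ∀ n c α → V.sum α ≢ n → coefSide l N n c α ≡ 0
  coefSide-0 n c α ne = trans (coefSide-swap n c α) (ΣL-0 (below α) (λ β∈ → ΣL-0 (upTo n) (λ i∈ → vanish β∈ (∈-upTo⁻ i∈))))
    where
    vanish : ∀ {β i} → β ∈ below α → i ℕ.< n → term n c α β i ≡ 0
    vanish {β} {i} β∈ i<n with V.sum β ℕP.≟ i
    ... | no β≢i   = term-≢ n c α β β≢i
    ... | yes refl = trans (cong (coefH i β ℕ.*_) (trans (coefQ-ornaments (n ∸ i) c γ) (ornaments-0 (n ∸ i) c γ γ≢))) (ℕP.*-zeroʳ (coefH i β))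
      where
      γ = zipWith _∸_ α β
      γ≢ : V.sum γ ≢ n ∸ i
      γ≢ eq = ne (trans (sym (below-sum α β∈)) (trans (cong (i ℕ.+_) eq) (ℕP.m+[n∸m]≡n (ℕP.<⇒≤ i<n))))

  -- For each β only i = `V.sum β` contributes, which merges the sum over i and the convolution into
  -- a single sum over β.
  coefSide-S : ∀ c α → + coefSide l N (V.sum α) c α ≡ S (+ c) α
  coefSide-S c α = trans (cong +_ (coefSide-swap n c α)) (ΣL-ℤ (below α) per-β)
    where
    n : ℕ
    n = V.sum α
    per-β : ∀ {β} → β ∈ below α → + ΣL (upTo n) (term n c α β) ≡ (Q ⊝ δ) (+ c) (zipWith _∸_ α β)
    per-β {β} β∈ with V.sum β ℕP.<? n
    ... | yes β<n = trans (cong +_ (trans (ΣL-cong (upTo n) (λ {i} _ → term-indicator n c α β i))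
                                          (ΣL-indicator (λ i → coefQ l N (n ∸ i) c γ) (UP.upTo⁺ n) (∈-upTo⁺ β<n))))
                   (trans (cong +_ (coefQ-ornaments (n ∸ V.sum β) c γ))
                   (trans (ornaments-Q (n ∸ V.sum β) c γ γ≡)
                   (trans (sym (ℤP.+-identityʳ (Q (+ c) γ)))
                          (cong (λ z → Q (+ c) γ - z) (sym (δ-vanishes (+ c) γ λ _ γ≡0 → ℕP.<⇒≢ (ℕP.m<n⇒0<n∸m β<n) (trans (sym γ≡0) γ≡)))))))
      where
      γ : Vec ℕ N
      γ = zipWith _∸_ α β
      γ≡ : V.sum γ ≡ n ∸ V.sum β
      γ≡ = trans (sym (ℕP.m+n∸m≡n (V.sum β) (V.sum γ))) (cong (_∸ V.sum β) (below-sum α β∈))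
    -- Here β has full degree, i = n is outside the sum, and on the right `Q` and `δ` agree in
    -- degree 0.
    ... | no β≮n = trans (cong +_ (ΣL-0 (upTo n) (λ {i} i∈ → term-≢ n c α β (λ { refl → β≮n (∈-upTo⁻ i∈) }))))
                         (sym (trans (cong (λ z → z - δ (+ c) γ) (Q-δ-0 (+ c) γ γ≡0)) (ℤP.+-inverseʳ (δ (+ c) γ))))
      where
      γ : Vec ℕ N
      γ = zipWith _∸_ α β
      γ≡0 : V.sum γ ≡ 0
      γ≡0 = ℕP.n≤0⇒n≡0 (ℕP.+-cancelˡ-≤ (V.sum β) _ _ (ℕP.≤-trans (ℕP.≤-reflexive (below-sum α β∈))
              (ℕP.≤-trans (ℕP.≮⇒≥ β≮n) (ℕP.≤-reflexive (sym (ℕP.+-identityʳ _))))))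

  -- `S-difference` is read at t^(a+1): the factor t lowers this to a, and the reflected exponent b
  -- + 1 to b. Both a + 1 and b + 1 are nonzero, while `H` lives in t^0, so the right side vanishes.
  S-symmetric : ∀ a b α → suc a ℕ.+ suc b ≡ l ℕ.* V.sum α → S (+ a) α ≡ S (+ b) α
  S-symmetric a b α eq = trans (ℤP.i-j≡0⇒i≡j _ _ (trans (at S-difference (+ suc a) α) H-zero)) (cong (λ i → S i α) reflected-1)
    where
    reflected : + (l ℕ.* V.sum α) - + suc a ≡ + suc b
    reflected = trans (cong (λ m → + m - + suc a) (sym eq)) (trans (cong (λ z → z - + suc a) (ℤP.pos-+ (suc a) (suc b))) (lemma (+ suc a) (+ suc b)))
      where
      lemma : ∀ p q → p + q - p ≡ q
      lemma = solve-∀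
    reflected-1 : + (l ℕ.* V.sum α) - + suc a - 1ℤ ≡ + b
    reflected-1 = cong (λ i → i - 1ℤ) reflected
    H-zero : H (+ (l ℕ.* V.sum α) - + suc a) α - H (+ suc a) α ≡ 0ℤ
    H-zero = cong₂ _-_ (trans (cong (λ i → H i α) reflected) (H-vanishes (+ suc b) α λ ())) (H-vanishes (+ suc a) α λ ())

open import Data.Nat using (_+_; _*_; _≤_)

theorem1p2 : (l n a b : ℕ) → 1 ≤ l → 1 ≤ n → 1 ≤ a → 1 ≤ b → a + b ≡ l * n →
    (N : ℕ) → (α : Vec ℕ N) →
    coefSide l N n (a ∸ 1) α ≡ coefSide l N n (b ∸ 1) α
theorem1p2 (suc l′) n (suc a) (suc b) (s≤s _) 1≤n (s≤s _) (s≤s _) eq N α with V.sum α ℕP.≟ n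
... | yes refl = ℤP.+-injective (trans (coefSide-S a α) (trans (S-symmetric a b α eq) (sym (coefSide-S b α))))
  where open Sides l′ N
-- Both sides are homogeneous of degree n.
... | no α≢n   = trans (coefSide-0 n a α α≢n) (sym (coefSide-0 n b α α≢n))
  where open Sides l′ N
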